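{- For any complete graph $K_n$, all complex roots of the Ehrhart polynomial $H_{K_n}$ of its symmetric edge polytope $P_{K_n}$ lie on the line $R=\{z\in\mathbb{C}:\operatorname{Re}(z)=-\tfrac12\}$.
   Context: For a finite simple undirected graph $G=(V,E)$, let $\mathbb{Z}^{|V|}$ be the lattice with basis $(e_v)_{v\in V}$. The symmetric edge polytope $P_G\subset\mathbb{R}^{|V|}$ is the convex hull of all vectors $e_{v_1}-e_{v_2}$ with $\{v_1,v_2\}\in E$ (both orders, so each edge contributes $\pm(e_{v_1}-e_{v_2})$). If $G$ has no edges, $P_G$ is taken to be $\{0\}$. The Ehrhart polynomial $H_G$ is the polynomial with $H_G(s)=|sP_G\cap\mathbb{Z}^{|V|}|$ for all integers $s\ge 0$. -}

module Defs where

open import Data.Bool.Base using (if_then_else_)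
open import Data.Fin.Base using (Fin)
open import Data.Fin.Properties using (_≟_)
open import Data.Integer.Base as ℤ using (ℤ)
open import Data.List.Base using (List; []; _∷_; length)
open import Data.List.Membership.Propositional using (_∈_)
open import Data.List.Relation.Unary.Unique.Propositional using (Unique)
open import Data.Nat.Base as ℕ using (ℕ)
import Data.Nat.Properties as ℕ
open import Data.Product.Base using (Σ; ∃-syntax; _×_; _,_; proj₁; proj₂)
open import Data.Rational.Base as ℚ using (ℚ; 0ℚ; 1ℚ; ½; ∣_∣; 1/_)
open import Data.Rational.Properties as ℚ
  using ( positive⁻¹; pos*pos⇒pos; pos+pos⇒pos; pos+nonNeg⇒pos; pos⇒nonZero; 1/pos⇒pos
        ; +-mono-<; +-mono-≤; +-monoˡ-≤; +-inverseʳ; *-comm; *-assoc; *-distribʳ-+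
        ; *-identityˡ; *-inverseʳ; *-monoˡ-≤-nonNeg; *-monoʳ-≤-nonNeg; *-monoˡ-<-pos
        ; *-monoʳ-<-pos; ∣p+q∣≤∣p∣+∣q∣; ∣p*q∣≡∣p∣*∣q∣; ∣-p∣≡∣p∣; 0≤∣p∣; <⇒≤; module ≤-Reasoning)
open import Data.Rational.Solver using (module +-*-Solver)
open import Data.Sum.Base using (_⊎_)
open import Data.Vec.Base as Vec using (Vec)
open import Data.Vec.Functional using (Vector; foldr)
open import Function.Base using (_∘_)
open import Function.Bundles using (_⇔_)
open import Level using (0ℓ)
open import Relation.Binary.Core using (Rel)
open import Relation.Binary.Definitions using (Decidable; Irreflexive; Symmetric)
open import Relation.Binary.PropositionalEquality
  using (_≡_; _≢_; refl; sym; trans; cong; cong₂; subst; ≢-sym)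
open import Relation.Nullary using (¬_; ¬?; does)
open import Relation.Unary using (Pred)

------------------------------------------------------------------------
-- Real numbers: Cauchy sequences of rationals, compared by the setoid
-- equality _≈_ ("the difference tends to 0").

IsCauchy : (ℕ → ℚ) → Set
IsCauchy x = ∀ ε → 0ℚ ℚ.< ε →
  ∃[ N ] (∀ m n → N ℕ.≤ m → N ℕ.≤ n → ∣ x m ℚ.- x n ∣ ℚ.< ε)

record ℝ : Set where
  constructor mkℝ
  field
    seq    : ℕ → ℚ
    cauchy : IsCauchy seq

open ℝ public

infix 4 _≈_ _≤_

_≈_ : ℝ → ℝ → Set
x ≈ y = ∀ ε → 0ℚ ℚ.< ε →
  ∃[ N ] (∀ n → N ℕ.≤ n → ∣ seq x n ℚ.- seq y n ∣ ℚ.< ε)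

_≤_ : ℝ → ℝ → Set
x ≤ y = ∀ ε → 0ℚ ℚ.< ε →
  ∃[ N ] (∀ n → N ℕ.≤ n → seq x n ℚ.- seq y n ℚ.< ε)

private
  half-pos : ∀ ε → 0ℚ ℚ.< ε → 0ℚ ℚ.< ½ ℚ.* ε
  half-pos ε 0<ε = positive⁻¹ (½ ℚ.* ε) {{pos*pos⇒pos ½ ε {{ℚ.positive 0<ε}}}}

  half+half : ∀ ε → ½ ℚ.* ε ℚ.+ ½ ℚ.* ε ≡ ε
  half+half = solve 1 (λ ε → con ½ :* ε :+ con ½ :* ε := ε) refl
    where open +-*-Solver

  ⊔-leftBound : ∀ {a b n} → a ℕ.⊔ b ℕ.≤ n → a ℕ.≤ n
  ⊔-leftBound {a} {b} = ℕ.≤-trans (ℕ.m≤m⊔n a b)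

  ⊔-rightBound : ∀ {a b n} → a ℕ.⊔ b ℕ.≤ n → b ℕ.≤ n
  ⊔-rightBound {a} {b} = ℕ.≤-trans (ℕ.m≤n⊔m a b)

  +-cauchy : ∀ x y → IsCauchy x → IsCauchy y → IsCauchy (λ n → x n ℚ.+ y n)
  +-cauchy x y cx cy ε 0<ε
    with cx (½ ℚ.* ε) (half-pos ε 0<ε) | cy (½ ℚ.* ε) (half-pos ε 0<ε)
  ... | M , hM | N , hN = M ℕ.⊔ N , λ m n Nm Nn → begin-strict
    ∣ (x m ℚ.+ y m) ℚ.- (x n ℚ.+ y n) ∣
      ≡⟨ cong ∣_∣ (lemma (x m) (y m) (x n) (y n)) ⟩
    ∣ (x m ℚ.- x n) ℚ.+ (y m ℚ.- y n) ∣
      ≤⟨ ∣p+q∣≤∣p∣+∣q∣ (x m ℚ.- x n) (y m ℚ.- y n) ⟩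
    ∣ x m ℚ.- x n ∣ ℚ.+ ∣ y m ℚ.- y n ∣
      <⟨ +-mono-< (hM m n (⊔-leftBound Nm) (⊔-leftBound Nn))
                  (hN m n (⊔-rightBound {M} Nm) (⊔-rightBound {M} Nn)) ⟩
    ½ ℚ.* ε ℚ.+ ½ ℚ.* ε
      ≡⟨ half+half ε ⟩
    ε ∎
    where
    open ≤-Reasoning
    lemma : ∀ a b c d → (a ℚ.+ b) ℚ.- (c ℚ.+ d) ≡ (a ℚ.- c) ℚ.+ (b ℚ.- d)
    lemma = solve 4 (λ a b c d → (a :+ b) :- (c :+ d) := (a :- c) :+ (b :- d)) refl
      where open +-*-Solver

  neg-cauchy : ∀ x → IsCauchy x → IsCauchy (λ n → ℚ.- x n)
  neg-cauchy x cx ε 0<ε with cx ε 0<ε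
  ... | N , hN = N , λ m n Nm Nn →
    subst (ℚ._< ε) (sym (lemma (x m) (x n))) (hN m n Nm Nn)
    where
    open +-*-Solver
    neg : ∀ a b → (ℚ.- a) ℚ.- (ℚ.- b) ≡ ℚ.- (a ℚ.- b)
    neg = solve 2 (λ a b → (:- a) :- (:- b) := :- (a :- b)) refl
    lemma : ∀ a b → ∣ (ℚ.- a) ℚ.- (ℚ.- b) ∣ ≡ ∣ a ℚ.- b ∣
    lemma a b = trans (cong ∣_∣ (neg a b)) (∣-p∣≡∣p∣ (a ℚ.- b))

  Bound : (ℕ → ℚ) → Set
  Bound x = ∃[ B ] ℚ.Positive B × ∃[ N ] (∀ n → N ℕ.≤ n → ∣ x n ∣ ℚ.≤ B)

  cauchy⇒bounded : ∀ x → IsCauchy x → Bound x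
  cauchy⇒bounded x cx with cx 1ℚ (positive⁻¹ 1ℚ)
  ... | N , hN = 1ℚ ℚ.+ ∣ x N ∣
               , pos+nonNeg⇒pos 1ℚ ∣ x N ∣ {{ℚ.nonNegative (0≤∣p∣ (x N))}}
               , N , λ n Nn → begin
    ∣ x n ∣                      ≡⟨ cong ∣_∣ (lemma (x n) (x N)) ⟩
    ∣ (x n ℚ.- x N) ℚ.+ x N ∣    ≤⟨ ∣p+q∣≤∣p∣+∣q∣ (x n ℚ.- x N) (x N) ⟩
    ∣ x n ℚ.- x N ∣ ℚ.+ ∣ x N ∣  ≤⟨ +-monoˡ-≤ ∣ x N ∣ (<⇒≤ (hN n N Nn ℕ.≤-refl)) ⟩
    1ℚ ℚ.+ ∣ x N ∣               ∎
    where
    open ≤-Reasoning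
    lemma : ∀ a b → a ≡ (a ℚ.- b) ℚ.+ b
    lemma = solve 2 (λ a b → a := (a :- b) :+ b) refl
      where open +-*-Solver

  *-cauchy′ : ∀ x y → Bound x → Bound y →
    IsCauchy x → IsCauchy y → IsCauchy (λ n → x n ℚ.* y n)
  *-cauchy′ x y (A , A>0 , K , hK) (B , B>0 , L , hL) cx cy ε 0<ε = proof
    where
    open ≤-Reasoning
    instance
      A⁺ = A>0
      B⁺ = B>0
      C⁺ : ℚ.Positive (A ℚ.+ B)
      C⁺ = pos+pos⇒pos A B
      C≢0 : ℚ.NonZero (A ℚ.+ B)
      C≢0 = pos⇒nonZero (A ℚ.+ B)
    δ : ℚ
    δ = 1/ (A ℚ.+ B) ℚ.* ε
    0<δ : 0ℚ ℚ.< δ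
    0<δ = positive⁻¹ δ {{pos*pos⇒pos (1/ (A ℚ.+ B)) {{1/pos⇒pos (A ℚ.+ B)}} ε {{ℚ.positive 0<ε}}}}
    Aδ+δB≡ε : A ℚ.* δ ℚ.+ δ ℚ.* B ≡ ε
    Aδ+δB≡ε = begin-equality
      A ℚ.* δ ℚ.+ δ ℚ.* B      ≡⟨ cong (A ℚ.* δ ℚ.+_) (*-comm δ B) ⟩
      A ℚ.* δ ℚ.+ B ℚ.* δ      ≡⟨ *-distribʳ-+ δ A B ⟨
      (A ℚ.+ B) ℚ.* δ          ≡⟨ *-assoc (A ℚ.+ B) (1/ (A ℚ.+ B)) ε ⟨
      ((A ℚ.+ B) ℚ.* 1/ (A ℚ.+ B)) ℚ.* ε  ≡⟨ cong (ℚ._* ε) (*-inverseʳ (A ℚ.+ B)) ⟩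
      1ℚ ℚ.* ε                 ≡⟨ *-identityˡ ε ⟩
      ε                        ∎
    split : ∀ a b c d → a ℚ.* b ℚ.- c ℚ.* d ≡ a ℚ.* (b ℚ.- d) ℚ.+ (a ℚ.- c) ℚ.* d
    split = solve 4 (λ a b c d → a :* b :- c :* d := a :* (b :- d) :+ (a :- c) :* d) refl
      where open +-*-Solver
    M = proj₁ (cx δ 0<δ)
    N = proj₁ (cy δ 0<δ)
    proof : ∃[ N ] (∀ m n → N ℕ.≤ m → N ℕ.≤ n → ∣ x m ℚ.* y m ℚ.- x n ℚ.* y n ∣ ℚ.< ε)
    proof = (K ℕ.⊔ L) ℕ.⊔ (M ℕ.⊔ N) , λ m n m≥ n≥ →
      let
        xm≤A = hK m (⊔-leftBound (⊔-leftBound m≥))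
        yn≤B = hL n (⊔-rightBound {K} (⊔-leftBound n≥))
        dx<δ = proj₂ (cx δ 0<δ) m n (⊔-leftBound (⊔-rightBound {K ℕ.⊔ L} m≥))
                                    (⊔-leftBound (⊔-rightBound {K ℕ.⊔ L} n≥))
        dy<δ = proj₂ (cy δ 0<δ) m n (⊔-rightBound {M} (⊔-rightBound {K ℕ.⊔ L} m≥))
                                    (⊔-rightBound {M} (⊔-rightBound {K ℕ.⊔ L} n≥))
        dx = x m ℚ.- x n
        dy = y m ℚ.- y n
      in begin-strict
      ∣ x m ℚ.* y m ℚ.- x n ℚ.* y n ∣
        ≡⟨ cong ∣_∣ (split (x m) (y m) (x n) (y n)) ⟩
      ∣ x m ℚ.* dy ℚ.+ dx ℚ.* y n ∣
        ≤⟨ ∣p+q∣≤∣p∣+∣q∣ (x m ℚ.* dy) (dx ℚ.* y n) ⟩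
      ∣ x m ℚ.* dy ∣ ℚ.+ ∣ dx ℚ.* y n ∣
        ≡⟨ cong₂ ℚ._+_ (∣p*q∣≡∣p∣*∣q∣ (x m) dy) (∣p*q∣≡∣p∣*∣q∣ dx (y n)) ⟩
      ∣ x m ∣ ℚ.* ∣ dy ∣ ℚ.+ ∣ dx ∣ ℚ.* ∣ y n ∣
        ≤⟨ +-mono-≤ (*-monoʳ-≤-nonNeg ∣ dy ∣ {{ℚ.nonNegative (0≤∣p∣ dy)}} xm≤A)
                    (*-monoˡ-≤-nonNeg ∣ dx ∣ {{ℚ.nonNegative (0≤∣p∣ dx)}} yn≤B) ⟩
      A ℚ.* ∣ dy ∣ ℚ.+ ∣ dx ∣ ℚ.* B
        <⟨ +-mono-< (*-monoʳ-<-pos A dy<δ) (*-monoˡ-<-pos B dx<δ) ⟩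
      A ℚ.* δ ℚ.+ δ ℚ.* B
        ≡⟨ Aδ+δB≡ε ⟩
      ε ∎

  *-cauchy : ∀ x y → IsCauchy x → IsCauchy y → IsCauchy (λ n → x n ℚ.* y n)
  *-cauchy x y cx cy = *-cauchy′ x y (cauchy⇒bounded x cx) (cauchy⇒bounded y cy) cx cy

infixl 6 _+_ _-_
infixl 7 _*_
infix  8 -_

_+_ : ℝ → ℝ → ℝ
x + y = mkℝ (λ n → seq x n ℚ.+ seq y n) (+-cauchy (seq x) (seq y) (cauchy x) (cauchy y))

_*_ : ℝ → ℝ → ℝ
x * y = mkℝ (λ n → seq x n ℚ.* seq y n) (*-cauchy (seq x) (seq y) (cauchy x) (cauchy y))

-_ : ℝ → ℝ
- x = mkℝ (λ n → ℚ.- seq x n) (neg-cauchy (seq x) (cauchy x))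

_-_ : ℝ → ℝ → ℝ
x - y = x + (- y)

fromℚ : ℚ → ℝ
fromℚ q = mkℝ (λ _ → q) λ ε 0<ε → 0 , λ _ _ _ _ →
  subst (λ d → ∣ d ∣ ℚ.< ε) (sym (+-inverseʳ q)) 0<ε

fromℤ : ℤ → ℝ
fromℤ i = fromℚ (i ℚ./ 1)

fromℕ : ℕ → ℝ
fromℕ k = fromℤ (ℤ.+ k)

0ℝ 1ℝ : ℝ
0ℝ = fromℚ 0ℚ
1ℝ = fromℚ 1ℚ

------------------------------------------------------------------------
-- Complex numbers and complex polynomials

record ℂ : Set where
  constructor _+i_
  field
    Re Im : ℝ

open ℂ public

infix  4 _≈ℂ_
infixl 6 _+ℂ_
infixl 7 _*ℂ_

_≈ℂ_ : ℂ → ℂ → Set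
z ≈ℂ w = (Re z ≈ Re w) × (Im z ≈ Im w)

_+ℂ_ _*ℂ_ : ℂ → ℂ → ℂ
z +ℂ w = (Re z + Re w) +i (Im z + Im w)
z *ℂ w = (Re z * Re w - Im z * Im w) +i (Re z * Im w + Im z * Re w)

fromℝ : ℝ → ℂ
fromℝ x = x +i 0ℝ

0ℂ : ℂ
0ℂ = fromℝ 0ℝ

-- The coefficient list a₀ ∷ a₁ ∷ … ∷ a_d ∷ [] stands for the polynomial
-- a₀ + a₁ s + … + a_d s^d; trailing zero coefficients are allowed.
Polynomial : Set
Polynomial = List ℂ

eval : Polynomial → ℂ → ℂ
eval []      z = 0ℂ
eval (a ∷ p) z = a +ℂ z *ℂ eval p z

IsRoot : Polynomial → ℂ → Set
IsRoot p z = eval p z ≈ℂ 0ℂ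

-- The line Re z = -1/2.
R : Pred ℂ 0ℓ
R z = Re z ≈ fromℚ (ℚ.- ½)

------------------------------------------------------------------------
-- Real vectors and polytopes

infix  4 _≋_
infixr 7 _·_

_≋_ : ∀ {n} → Vector ℝ n → Vector ℝ n → Set
x ≋ y = ∀ i → x i ≈ y i

sum : ∀ {k} → Vector ℝ k → ℝ
sum = foldr _+_ 0ℝ

_·_ : ∀ {n} → ℝ → Vector ℝ n → Vector ℝ n
(c · x) i = c * x i

basis : ∀ {n} → Fin n → Vector ℝ n
basis v i = if does (v ≟ i) then 1ℝ else 0ℝ

ConvexHull : ∀ {n} → Pred (Vector ℝ n) 0ℓ → Pred (Vector ℝ n) 0ℓ
ConvexHull S x =
  ∃[ k ] Σ (Vector ℝ k) λ c → Σ (Fin k → Vector ℝ _) λ p →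
    (∀ j → 0ℝ ≤ c j) ×
    sum c ≈ 1ℝ ×
    (∀ j → S (p j)) ×
    x ≋ (λ i → sum (λ j → c j * p j i))

dilate : ∀ {n} → ℝ → Pred (Vector ℝ n) 0ℓ → Pred (Vector ℝ n) 0ℓ
dilate s P x = ∃[ y ] P y × x ≋ s · y

LatticePoint : ∀ {n} → Pred (Vector ℝ n) 0ℓ → Pred (Vec ℤ n) 0ℓ
LatticePoint P a = P (fromℤ ∘ Vec.lookup a)

HasCardinality : ∀ {A : Set} → Pred A 0ℓ → ℕ → Set
HasCardinality P k =
  ∃[ xs ] Unique xs × (∀ x → x ∈ xs ⇔ P x) × length xs ≡ k

------------------------------------------------------------------------
-- Symmetric edge polytopes

record SimpleGraph (n : ℕ) : Set₁ where
  field
    _~_   : Rel (Fin n) 0ℓ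
    ~-sym : Symmetric _~_
    ~-irr : Irreflexive _≡_ _~_
    _~?_  : Decidable _~_

completeGraph : ∀ n → SimpleGraph n
completeGraph n = record
  { _~_   = _≢_
  ; ~-sym = ≢-sym
  ; ~-irr = λ i≡j i≢j → i≢j i≡j
  ; _~?_  = λ i j → ¬? (i ≟ j)
  }

module _ {n} (G : SimpleGraph n) where
  open SimpleGraph G

  HasEdge : Set
  HasEdge = ∃[ u ] ∃[ v ] u ~ v

  EdgeVector : Pred (Vector ℝ n) 0ℓ
  EdgeVector x = ∃[ u ] ∃[ v ] (u ~ v) × x ≋ (λ i → basis u i - basis v i)

  -- The convex hull of no vectors is empty, so the convention that an
  -- edgeless graph has polytope {0} needs its own case.
  symmetricEdgePolytope : Pred (Vector ℝ n) 0ℓ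
  symmetricEdgePolytope x =
    (HasEdge × ConvexHull EdgeVector x) ⊎ (¬ HasEdge × x ≋ (λ _ → 0ℝ))

  IsEhrhartPolynomial : Polynomial → Set
  IsEhrhartPolynomial H = ∀ (s : ℕ) → ∃[ k ]
    HasCardinality (LatticePoint (dilate (fromℕ s) symmetricEdgePolytope)) k ×
    eval H (fromℝ (fromℕ s)) ≈ℂ fromℝ (fromℕ k)

{-# OPTIONS --safe #-}

-- With d = n - 1, the lattice points of sP are the x ∈ ℤⁿ of sum 0 whose positive entries
-- sum to at most s, and their number is D_d(s) = Σ_p (d choose p) (s choose p) (s+d-p choose d-p).
-- It satisfies D₀ = 1, D₁ = 2s + 1 and
--   (d+2)² D_{d+2} = (2d+3)(2s+1) D_{d+1} + (d+1)² D_d.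
-- Multiplying this by the conjugate of D_{d+1}(z) and taking real parts shows inductively that
-- Re (D_{d+1}(z) D̄_d(z)) is Re (2z + 1) times a quantity bounded below by a positive constant,
-- so every root of D_{d+1} has Re (2z + 1) = 0. The real numbers are handled through their
-- approximating rational sequences, where all algebraic identities hold exactly.
module Submission where

-- Put 2s + 1 = i t and D_d = i^d p_d. The recurrence becomes (d+2)² p_{d+2} = (2d+3) t p_{d+1} -
-- (d+1)² p_d, the shape satisfied by orthogonal polynomials on the real line; real zeros t are
-- zeros s with real part -1/2, and the induction on Re (D_{d+1} D̄_d) is the Christoffel-Darboux
-- identity in this variable.
--
-- `IsEhrhartPolynomial` constrains `H` only through its values at natural numbers, and only up to
-- `_≈_`. Equality of Cauchy reals is not decidable, so neither the degree of `H` nor a leading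
-- coefficient can be read off. Instead of normalising `H`, one forms (d!)² H minus an explicit
-- polynomial with integer coefficients and divides out linear factors z - s as often as it has
-- coefficients; what remains is the empty polynomial.
--
-- For the same reason a vanishing product does not yield a vanishing factor. A lower bound S ≥ 1,
-- valid for each approximant separately, replaces that argument: it gives |w| ≤ |w S|, so w tends
-- to 0 whenever w S does, even if S itself has no limit.

-- Binomial convolutions and the three-term recurrence

module Convolution where

  open import Data.Integer.Base using (ℤ; +_; 0ℤ; 1ℤ; _+_; _*_; _-_; -_)
  import Data.Integer.Properties as ℤ
  open import Data.Integer.Tactic.RingSolver using (solve-∀)
  open import Data.Nat.Base as ℕ using (ℕ; zero; suc)
  import Data.Nat.Properties as ℕ
  open import Data.Nat.Combinatorics using (_C_; nC1≡n; nCk+nC[k+1]≡[n+1]C[k+1])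
  import Data.Nat.Tactic.RingSolver as ℕ-Solver
  open import Relation.Binary.PropositionalEquality
  open ≡-Reasoning

  -- Common source of the first-order relations `count-p` and `count-q`; Pascal's rule reduces both
  -- factors on the right to smaller n.
  absorption : ∀ n k → suc k ℕ.* (suc n C suc k) ≡ suc n ℕ.* (n C k)
  absorption zero    zero    = refl
  absorption zero    (suc k) = ℕ.*-zeroʳ (suc (suc k))
  absorption (suc n) zero    = trans (ℕ.*-identityˡ _) (trans (nC1≡n (suc (suc n))) (sym (ℕ.*-identityʳ _)))
  absorption (suc n) (suc k) = begin
    suc (suc k) ℕ.* (suc (suc n) C suc (suc k))
      ≡⟨ cong (suc (suc k) ℕ.*_) (nCk+nC[k+1]≡[n+1]C[k+1] (suc n) (suc k)) ⟨
    suc (suc k) ℕ.* (c₁ ℕ.+ c₂)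
      ≡⟨ split k c₁ c₂ ⟩
    c₁ ℕ.+ suc k ℕ.* c₁ ℕ.+ suc (suc k) ℕ.* c₂
      ≡⟨ cong₂ (λ x y → c₁ ℕ.+ x ℕ.+ y) (absorption n k) (absorption n (suc k)) ⟩
    c₁ ℕ.+ suc n ℕ.* (n C k) ℕ.+ suc n ℕ.* (n C suc k)
      ≡⟨ merge c₁ n (n C k) (n C suc k) ⟩
    c₁ ℕ.+ suc n ℕ.* (n C k ℕ.+ n C suc k)
      ≡⟨ cong (λ x → c₁ ℕ.+ suc n ℕ.* x) (nCk+nC[k+1]≡[n+1]C[k+1] n k) ⟩
    suc (suc n) ℕ.* c₁ ∎
    where
    c₁ = suc n C suc k
    c₂ = suc n C suc (suc k)
    split : ∀ k c₁ c₂ → suc (suc k) ℕ.* (c₁ ℕ.+ c₂) ≡ c₁ ℕ.+ suc k ℕ.* c₁ ℕ.+ suc (suc k) ℕ.* c₂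
    split = ℕ-Solver.solve-∀
    merge : ∀ c n a b → c ℕ.+ suc n ℕ.* a ℕ.+ suc n ℕ.* b ≡ c ℕ.+ suc n ℕ.* (a ℕ.+ b)
    merge = ℕ-Solver.solve-∀

  -- bin d f is the sum of (d choose p) f p q over all p + q = d.
  bin : ℕ → (ℕ → ℕ → ℤ) → ℤ
  bin zero    f = f 0 0
  bin (suc d) f = bin d (λ p q → f (suc p) q) + bin d (λ p q → f p (suc q))

  bin-cong : ∀ d (f g : ℕ → ℕ → ℤ) → (∀ p q → p ℕ.+ q ≡ d → f p q ≡ g p q) → bin d f ≡ bin d g
  bin-cong zero    f g f≡g = f≡g 0 0 refl
  bin-cong (suc d) f g f≡g = cong₂ _+_
    (bin-cong d (λ p q → f (suc p) q) (λ p q → g (suc p) q) λ p q e → f≡g (suc p) q (cong suc e))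
    (bin-cong d (λ p q → f p (suc q)) (λ p q → g p (suc q)) λ p q e → f≡g p (suc q) (trans (ℕ.+-suc p q) (cong suc e)))

  bin-+ : ∀ d (f g : ℕ → ℕ → ℤ) → bin d (λ p q → f p q + g p q) ≡ bin d f + bin d g
  bin-+ zero    f g = refl
  bin-+ (suc d) f g = trans
    (cong₂ _+_ (bin-+ d (λ p q → f (suc p) q) (λ p q → g (suc p) q))
               (bin-+ d (λ p q → f p (suc q)) (λ p q → g p (suc q))))
    (interchange (bin d λ p q → f (suc p) q) _ _ _)
    where
    interchange : ∀ a b c d → (a + b) + (c + d) ≡ (a + c) + (b + d)
    interchange = solve-∀

  bin-* : ∀ d c (f : ℕ → ℕ → ℤ) → bin d (λ p q → c * f p q) ≡ c * bin d f
  bin-* zero    c f = refl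
  bin-* (suc d) c f = trans
    (cong₂ _+_ (bin-* d c (λ p q → f (suc p) q)) (bin-* d c (λ p q → f p (suc q))))
    (sym (ℤ.*-distribˡ-+ c _ _))

  -- Absorption for the implicit weights: p (d+1 choose p) = (d+1) (d choose p-1). A factor p is
  -- thus traded for a sum of order one less, which is what makes the moment method run.
  bin-p : ∀ d (f : ℕ → ℕ → ℤ) → bin (suc d) (λ p q → + p * f p q) ≡ + suc d * bin d (λ p q → f (suc p) q)
  bin-p zero    f = ℤ.+-identityʳ _
  bin-p (suc d) f = begin
    bin (suc d) (λ p q → + suc p * f (suc p) q) + bin (suc d) (λ p q → + p * f p (suc q))
      ≡⟨ cong₂ _+_
           (trans (bin-cong (suc d) (λ p q → + suc p * f (suc p) q) (λ p q → f (suc p) q + + p * f (suc p) q) λ p q _ → ℤ.suc-* (+ p) (f (suc p) q))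
                  (bin-+ (suc d) (λ p q → f (suc p) q) (λ p q → + p * f (suc p) q)))
           (bin-p d (λ p q → f p (suc q))) ⟩
    (e + bin (suc d) (λ p q → + p * f (suc p) q)) + + suc d * e₂
      ≡⟨ cong (λ x → (e + x) + + suc d * e₂) (bin-p d (λ p q → f (suc p) q)) ⟩
    (e + + suc d * e₁) + + suc d * e₂
      ≡⟨ collect (+ suc d) e₁ e₂ ⟩
    (1ℤ + + suc d) * e ∎
    where
    e₁ = bin d (λ p q → f (suc (suc p)) q)
    e₂ = bin d (λ p q → f (suc p) (suc q))
    e  = e₁ + e₂
    collect : ∀ n a b → ((a + b) + n * a) + n * b ≡ (1ℤ + n) * (a + b)
    collect = solve-∀

  bin-q : ∀ d (f : ℕ → ℕ → ℤ) → bin (suc d) (λ p q → + q * f p q) ≡ + suc d * bin d (λ p q → f p (suc q))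
  bin-q zero    f = ℤ.+-identityˡ _
  bin-q (suc d) f = begin
    bin (suc d) (λ p q → + q * f (suc p) q) + bin (suc d) (λ p q → + suc q * f p (suc q))
      ≡⟨ cong₂ _+_
           (bin-q d (λ p q → f (suc p) q))
           (trans (bin-cong (suc d) (λ p q → + suc q * f p (suc q)) (λ p q → f p (suc q) + + q * f p (suc q)) λ p q _ → ℤ.suc-* (+ q) (f p (suc q)))
                  (bin-+ (suc d) (λ p q → f p (suc q)) (λ p q → + q * f p (suc q)))) ⟩
    + suc d * e₁ + (e + bin (suc d) (λ p q → + q * f p (suc q)))
      ≡⟨ cong (λ x → + suc d * e₁ + (e + x)) (bin-q d (λ p q → f p (suc q))) ⟩
    + suc d * e₁ + (e + + suc d * e₂)
      ≡⟨ collect (+ suc d) e₁ e₂ ⟩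
    (1ℤ + + suc d) * e ∎
    where
    e₁ = bin d (λ p q → f (suc p) (suc q))
    e₂ = bin d (λ p q → f p (suc (suc q)))
    e  = e₁ + e₂
    collect : ∀ n a b → n * a + ((a + b) + n * b) ≡ (1ℤ + n) * (a + b)
    collect = solve-∀

  -- With p prescribed entries positive of sum at most a there are (a choose p) choices; with q
  -- prescribed entries nonpositive of absolute sum at most b there are (b+q choose q). `bin`
  -- supplies the choice of the positions.
  count : ℕ → ℕ → ℕ → ℕ → ℤ
  count a b p q = + ((a C p) ℕ.* ((b ℕ.+ q) C q))

  -- Absorption and Pascal's rule give (p+1) ((s choose p) + (s choose p+1)) = (s+1) (s choose p),
  -- and the first summand is subtracted. Working in ℤ also covers p ≥ s, where both sides are 0.
  count-p : ∀ s p q → + suc p * count s s (suc p) q ≡ (+ s - + p) * count s s p q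
  count-p s p q = begin
    + suc p * + ((s C suc p) ℕ.* c)          ≡⟨ cong (+ suc p *_) (ℤ.pos-* (s C suc p) c) ⟩
    + suc p * (+ (s C suc p) * + c)        ≡⟨ lemma (+ p) (+ s) (+ (s C p)) (+ (s C suc p)) (+ c) step ⟩
    (+ s - + p) * (+ (s C p) * + c)        ≡⟨ cong ((+ s - + p) *_) (ℤ.pos-* (s C p) c) ⟨
    (+ s - + p) * count s s p q ∎
    where
    c = (s ℕ.+ q) C q
    step : + suc p * (+ (s C p) + + (s C suc p)) ≡ + suc s * + (s C p)
    step = trans (cong (λ x → + suc p * + x) (nCk+nC[k+1]≡[n+1]C[k+1] s p))
          (trans (sym (ℤ.pos-* (suc p) _))
          (trans (cong +_ (absorption s p)) (ℤ.pos-* (suc s) _)))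
    lemma : ∀ p s a b c → (1ℤ + p) * (a + b) ≡ (1ℤ + s) * a → (1ℤ + p) * (b * c) ≡ (s - p) * (a * c)
    lemma p s a b c e = begin
      (1ℤ + p) * (b * c)                            ≡⟨ l₁ p a b c ⟩
      ((1ℤ + p) * (a + b) - (1ℤ + p) * a) * c       ≡⟨ cong (λ x → (x - (1ℤ + p) * a) * c) e ⟩
      ((1ℤ + s) * a - (1ℤ + p) * a) * c             ≡⟨ l₂ p s a c ⟩
      (s - p) * (a * c) ∎
      where
      l₁ : ∀ p a b c → (1ℤ + p) * (b * c) ≡ ((1ℤ + p) * (a + b) - (1ℤ + p) * a) * c
      l₁ = solve-∀
      l₂ : ∀ p s a c → ((1ℤ + s) * a - (1ℤ + p) * a) * c ≡ (s - p) * (a * c)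
      l₂ = solve-∀

  count-q : ∀ s p q → + suc q * count s s p (suc q) ≡ (+ suc s + + q) * count s s p q
  count-q s p q = begin
    + suc q * + ((s C p) ℕ.* ((s ℕ.+ suc q) C suc q))
      ≡⟨ ℤ.pos-* (suc q) ((s C p) ℕ.* ((s ℕ.+ suc q) C suc q)) ⟨
    + (suc q ℕ.* ((s C p) ℕ.* ((s ℕ.+ suc q) C suc q)))
      ≡⟨ cong +_ (begin
           suc q ℕ.* ((s C p) ℕ.* ((s ℕ.+ suc q) C suc q))
             ≡⟨ cong (λ n → suc q ℕ.* ((s C p) ℕ.* (n C suc q))) (ℕ.+-suc s q) ⟩
           suc q ℕ.* ((s C p) ℕ.* (suc (s ℕ.+ q) C suc q))
             ≡⟨ swap (suc q) (s C p) _ ⟩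
           (s C p) ℕ.* (suc q ℕ.* (suc (s ℕ.+ q) C suc q))
             ≡⟨ cong ((s C p) ℕ.*_) (absorption (s ℕ.+ q) q) ⟩
           (s C p) ℕ.* (suc (s ℕ.+ q) ℕ.* ((s ℕ.+ q) C q))
             ≡⟨ swap (s C p) (suc (s ℕ.+ q)) _ ⟩
           suc (s ℕ.+ q) ℕ.* ((s C p) ℕ.* ((s ℕ.+ q) C q)) ∎) ⟩
    + (suc (s ℕ.+ q) ℕ.* ((s C p) ℕ.* ((s ℕ.+ q) C q)))
      ≡⟨ ℤ.pos-* (suc (s ℕ.+ q)) _ ⟩
    (+ suc s + + q) * count s s p q ∎
    where
    swap : ∀ a b c → a ℕ.* (b ℕ.* c) ≡ b ℕ.* (a ℕ.* c)
    swap = ℕ-Solver.solve-∀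

  bin-1 : ∀ s → bin 1 (count s s) ≡ + 2 * + s + 1ℤ
  bin-1 s = trans (cong₂ _+_ e₁ e₂) (lemma (+ s))
    where
    e₁ : count s s 1 0 ≡ + s
    e₁ = cong +_ (trans (ℕ.*-identityʳ _) (nC1≡n s))
    e₂ : count s s 0 1 ≡ + s + 1ℤ
    e₂ = cong +_ (trans (ℕ.*-identityˡ _) (nC1≡n (s ℕ.+ 1)))
    lemma : ∀ s → s + (s + 1ℤ) ≡ + 2 * s + 1ℤ
    lemma = solve-∀

  -- The weights u satisfy first-order relations in p and in q. They express the
  -- moments of p and of q = d - p under bin d u by moments under bin (d - 1) u,
  -- and comparing the two kinds of moments gives 2M₁≡ in order two and cubic in order three.
  module Recurrence (s : ℕ) (u : ℕ → ℕ → ℤ)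
    (u-p : ∀ p q → + suc p * u (suc p) q ≡ (+ s - + p) * u p q)
    (u-q : ∀ p q → + suc q * u p (suc q) ≡ (+ suc s + + q) * u p q)
    where

    u₁ u₂ v₁ v₂ : ℕ → ℕ → ℤ
    u₁ p q = + p * u p q
    u₂ p q = + p * u₁ p q
    v₁ p q = + q * u p q
    v₂ p q = + q * v₁ p q

    D M₁ M₂ : ℕ → ℤ
    D  d = bin d u
    M₁ d = bin d u₁
    M₂ d = bin d u₂

    q≡d-p : ∀ {d} p q → p ℕ.+ q ≡ d → + q ≡ + d - + p
    q≡d-p p q refl = lemma (+ p) (+ q)
      where
      lemma : ∀ p q → q ≡ (p + q) - p
      lemma = solve-∀

    -- On the range p + q = d a factor q is d - p, so moments of q are combinations of moments of p,
    -- and `D`, `M₁`, `M₂` are the only unknowns up to order two.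
    quadratic : ∀ d (f : ℕ → ℕ → ℤ) a b c →
      (∀ p q → p ℕ.+ q ≡ d → f p q ≡ a * u p q + b * (+ p * u p q) + c * (+ p * (+ p * u p q))) →
      bin d f ≡ a * D d + b * M₁ d + c * M₂ d
    quadratic d f a b c f≡ = trans (bin-cong d _ _ f≡) (trans (bin-+ d (λ p q → a * u p q + b * u₁ p q) (λ p q → c * u₂ p q))
      (cong₂ _+_ (trans (bin-+ d (λ p q → a * u p q) (λ p q → b * u₁ p q))
                        (cong₂ _+_ (bin-* d a u) (bin-* d b u₁)))
                 (bin-* d c u₂)))

    module _ (m : ℕ) where

      private
        n = suc m

      -- One factor p is spent on `bin-p`, which lowers the order; the other one, now p + 1, is
      -- absorbed by `u-p`. Only moments of order at most one remain on the right.
      M₂-step : M₂ n ≡ + n * (+ s * D m - M₁ m)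
      M₂-step = trans (bin-p m u₁) (cong (+ n *_) (trans
        (quadratic m (λ p q → + suc p * u (suc p) q) (+ s) (- 1ℤ) 0ℤ λ p q _ → trans (u-p p q) (lemma (+ s) (+ p) (u p q)))
        (tidy (+ s) (D m) (M₁ m) (M₂ m))))
        where
        lemma : ∀ s p x → (s - p) * x ≡ s * x + (- 1ℤ) * (p * x) + 0ℤ * (p * (p * x))
        lemma = solve-∀
        tidy : ∀ s a b c → s * a + (- 1ℤ) * b + 0ℤ * c ≡ s * a - b
        tidy = solve-∀

      N₂-step : bin n v₂ ≡ + n * ((+ suc s + + m) * D m - M₁ m)
      N₂-step = trans (bin-q m v₁) (cong (+ n *_) (trans
        (quadratic m (λ p q → + suc q * u p (suc q)) (+ suc s + + m) (- 1ℤ) 0ℤ λ p q e → trans (u-q p q)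
          (trans (cong (λ x → (+ suc s + x) * u p q) (q≡d-p p q e)) (lemma (+ suc s) (+ m) (+ p) (u p q))))
        (tidy (+ suc s + + m) (D m) (M₁ m) (M₂ m))))
        where
        lemma : ∀ s m p x → (s + (m - p)) * x ≡ (s + m) * x + (- 1ℤ) * (p * x) + 0ℤ * (p * (p * x))
        lemma = solve-∀
        tidy : ∀ s a b c → s * a + (- 1ℤ) * b + 0ℤ * c ≡ s * a - b
        tidy = solve-∀

      N₂-expand : bin n v₂ ≡ (+ n * + n) * D n + (- (+ 2 * + n)) * M₁ n + 1ℤ * M₂ n
      N₂-expand = quadratic n v₂ (+ n * + n) (- (+ 2 * + n)) 1ℤ λ p q e →
        trans (cong (λ x → x * (x * u p q)) (q≡d-p p q e)) (lemma (+ n) (+ p) (u p q))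
        where
        lemma : ∀ n p x → (n - p) * ((n - p) * x) ≡ (n * n) * x + (- (+ 2 * n)) * (p * x) + 1ℤ * (p * (p * x))
        lemma = solve-∀

      -- `N₂-expand` and `N₂-step` evaluate the same sum. Once `M₂-step` is inserted, the terms in
      -- `M₁ m` and those in s cancel, and the common factor n is divided out.
      2M₁≡ : + 2 * M₁ n ≡ + n * (D n - D m)
      2M₁≡ = ℤ.*-cancelˡ-≡ (+ n) _ _ (lemma (+ s) (+ m) (D n) (D m) (M₁ n) (M₁ m) (M₂ n) M₂-step (trans (sym N₂-expand) N₂-step))
        where
        lemma : ∀ s m Dn Dm M1n M1m M2n → M2n ≡ (1ℤ + m) * (s * Dm - M1m) →
          ((1ℤ + m) * (1ℤ + m)) * Dn + (- (+ 2 * (1ℤ + m))) * M1n + 1ℤ * M2n ≡ (1ℤ + m) * (((1ℤ + s) + m) * Dm - M1m) →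
          (1ℤ + m) * (+ 2 * M1n) ≡ (1ℤ + m) * ((1ℤ + m) * (Dn - Dm))
        lemma s m Dn Dm M1n M1m _ refl e = begin
          (1ℤ + m) * (+ 2 * M1n) ≡⟨ l₁ s m Dn Dm M1n M1m ⟩
          (1ℤ + m) * (1ℤ + m) * Dn + (1ℤ + m) * (s * Dm - M1m) - _ ≡⟨ cong (λ x → (1ℤ + m) * (1ℤ + m) * Dn + (1ℤ + m) * (s * Dm - M1m) - x) e ⟩
          (1ℤ + m) * (1ℤ + m) * Dn + (1ℤ + m) * (s * Dm - M1m) - _ ≡⟨ l₂ s m Dn Dm M1m ⟩
          (1ℤ + m) * ((1ℤ + m) * (Dn - Dm)) ∎
          where
          l₁ : ∀ s m Dn Dm M1n M1m → (1ℤ + m) * (+ 2 * M1n) ≡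
            (1ℤ + m) * (1ℤ + m) * Dn + (1ℤ + m) * (s * Dm - M1m) -
            (((1ℤ + m) * (1ℤ + m)) * Dn + (- (+ 2 * (1ℤ + m))) * M1n + 1ℤ * ((1ℤ + m) * (s * Dm - M1m)))
          l₁ = solve-∀
          l₂ : ∀ s m Dn Dm M1m → (1ℤ + m) * (1ℤ + m) * Dn + (1ℤ + m) * (s * Dm - M1m) -
            (1ℤ + m) * (((1ℤ + s) + m) * Dm - M1m) ≡ (1ℤ + m) * ((1ℤ + m) * (Dn - Dm))
          l₂ = solve-∀

      M₃ N₃ : ℤ
      M₃ = bin n (λ p q → + p * u₂ p q)
      N₃ = bin n (λ p q → + q * v₂ p q)

      M₃-step : M₃ ≡ + n * (+ s * D m + (+ s - 1ℤ) * M₁ m + (- 1ℤ) * M₂ m)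
      M₃-step = trans (bin-p m u₂) (cong (+ n *_) (quadratic m (λ p q → + suc p * (+ suc p * u (suc p) q)) (+ s) (+ s - 1ℤ) (- 1ℤ) λ p q _ →
        trans (cong (+ suc p *_) (u-p p q)) (lemma (+ s) (+ p) (u p q))))
        where
        lemma : ∀ s p x → (1ℤ + p) * ((s - p) * x) ≡ s * x + (s - 1ℤ) * (p * x) + (- 1ℤ) * (p * (p * x))
        lemma = solve-∀

      N₃-step : N₃ ≡ + n * ((1ℤ + + s + (+ 2 + + s) * + m + + m * + m) * D m + (- (+ 2 + + s + + 2 * + m)) * M₁ m + 1ℤ * M₂ m)
      N₃-step = trans (bin-q m v₂) (cong (+ n *_) (quadratic m (λ p q → + suc q * (+ suc q * u p (suc q)))
        (1ℤ + + s + (+ 2 + + s) * + m + + m * + m) (- (+ 2 + + s + + 2 * + m)) 1ℤ λ p q e →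
        trans (cong (+ suc q *_) (u-q p q))
          (trans (cong (λ x → (1ℤ + x) * ((+ suc s + x) * u p q)) (q≡d-p p q e))
          (lemma (+ s) (+ m) (+ p) (u p q)))))
        where
        lemma : ∀ s m p x → (1ℤ + (m - p)) * (((1ℤ + s) + (m - p)) * x) ≡
          (1ℤ + s + (+ 2 + s) * m + m * m) * x + (- (+ 2 + s + + 2 * m)) * (p * x) + 1ℤ * (p * (p * x))
        lemma = solve-∀

      N₃-expand : N₃ ≡ + n * + n * + n * D n + (- (+ 3 * (+ n * + n))) * M₁ n + (+ 3 * + n) * M₂ n + (- 1ℤ) * M₃
      N₃-expand = trans (bin-cong n (λ p q → + q * v₂ p q) (λ p q → a * u p q + b * u₁ p q + c * u₂ p q + - 1ℤ * (+ p * u₂ p q)) λ p q e →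
          trans (cong (λ x → x * (x * (x * u p q))) (q≡d-p p q e)) (lemma (+ n) (+ p) (u p q)))
        (trans (bin-+ n (λ p q → a * u p q + b * u₁ p q + c * u₂ p q) (λ p q → - 1ℤ * (+ p * u₂ p q)))
          (cong₂ _+_ (quadratic n (λ p q → a * u p q + b * u₁ p q + c * u₂ p q) a b c λ _ _ _ → refl)
                     (bin-* n (- 1ℤ) (λ p q → + p * u₂ p q))))
        where
        a = + n * + n * + n
        b = - (+ 3 * (+ n * + n))
        c = + 3 * + n
        lemma : ∀ n p x → (n - p) * ((n - p) * ((n - p) * x)) ≡
          n * n * n * x + (- (+ 3 * (n * n))) * (p * x) + (+ 3 * n) * (p * (p * x)) + (- 1ℤ) * (p * (p * (p * x)))
        lemma = solve-∀

      -- The third moment of q evaluated in two ways. `M₂-step` and `M₃-step` make `M₂ n` and `M₃`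
      -- multiples of n, so n cancels throughout and the only unknowns of order n left are `D n` and
      -- `M₁ n`.
      cubic : + n * + n * D n - + 3 * + n * M₁ n + + 3 * + n * (+ s * D m - M₁ m)
                - (+ s * D m + (+ s - 1ℤ) * M₁ m + (- 1ℤ) * M₂ m)
            ≡ (1ℤ + + s + (+ 2 + + s) * + m + + m * + m) * D m + (- (+ 2 + + s + + 2 * + m)) * M₁ m + 1ℤ * M₂ m
      cubic = ℤ.*-cancelˡ-≡ (+ n) _ _ (trans
        (lemma (+ n) (D n) (M₁ n) _ _ _ _ M₂-step M₃-step)
        (trans (sym N₃-expand) N₃-step))
        where
        lemma : ∀ n D M1 M2 M3 x y → M2 ≡ n * x → M3 ≡ n * y →
          n * (n * n * D - + 3 * n * M1 + + 3 * n * x - y) ≡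
          n * n * n * D + (- (+ 3 * (n * n))) * M1 + (+ 3 * n) * M2 + (- 1ℤ) * M3
        lemma n D M1 _ _ x y refl refl = l n D M1 x y
          where
          l : ∀ n D M1 x y → n * (n * n * D - + 3 * n * M1 + + 3 * n * x - y) ≡
            n * n * n * D + (- (+ 3 * (n * n))) * M1 + (+ 3 * n) * (n * x) + (- 1ℤ) * (n * y)
          l = solve-∀

    -- In `cubic` the moment `M₂ m` has coefficient 1 on both sides and drops out. `2M₁≡` at orders
    -- d + 2 and d + 1 then removes the two first moments, leaving `D` at three consecutive orders.
    recurrence : ∀ d → + suc (suc d) * + suc (suc d) * D (suc (suc d)) ≡
      (+ 2 * + suc d + 1ℤ) * (+ 2 * + s + 1ℤ) * D (suc d) + + suc d * + suc d * D d
    recurrence d = combine (+ s) (+ suc d) _ _ _ _ _ _ (cubic (suc d)) (2M₁≡ (suc d)) (2M₁≡ d)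
      where
      combine : ∀ s m Dn Dm Dl M1n M1m M2m →
        (1ℤ + m) * (1ℤ + m) * Dn - + 3 * (1ℤ + m) * M1n + + 3 * (1ℤ + m) * (s * Dm - M1m)
            - (s * Dm + (s - 1ℤ) * M1m + (- 1ℤ) * M2m)
          ≡ (1ℤ + s + (+ 2 + s) * m + m * m) * Dm + (- (+ 2 + s + + 2 * m)) * M1m + 1ℤ * M2m →
        + 2 * M1n ≡ (1ℤ + m) * (Dn - Dm) → + 2 * M1m ≡ m * (Dm - Dl) →
        (1ℤ + m) * (1ℤ + m) * Dn ≡ (+ 2 * m + 1ℤ) * (+ 2 * s + 1ℤ) * Dm + m * m * Dl
      -- The multipliers -2, -3 (1 + m) and -m of the three hypotheses are forced by cancelling M1n
      -- and M1m; the rest is a ring identity.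
      combine s m Dn Dm Dl M1n M1m M2m x a b = ℤ.i-j≡0⇒i≡j _ _ (begin
        _ ≡⟨ l s m Dn Dm Dl M1n M1m M2m ⟩
        _ ≡⟨ cong₂ _+_ (cong₂ _+_ (cong (- + 2 *_) (ℤ.i≡j⇒i-j≡0 x))
                                  (cong (- (+ 3 * (1ℤ + m)) *_) (ℤ.i≡j⇒i-j≡0 a)))
                       (cong (- m *_) (ℤ.i≡j⇒i-j≡0 b)) ⟩
        (- + 2 * 0ℤ + - (+ 3 * (1ℤ + m)) * 0ℤ) + - m * 0ℤ ≡⟨ z m ⟩
        0ℤ ∎)
        where
        z : ∀ m → (- + 2 * 0ℤ + - (+ 3 * (1ℤ + m)) * 0ℤ) + - m * 0ℤ ≡ 0ℤ
        z = solve-∀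
        l : ∀ s m Dn Dm Dl M1n M1m M2m →
          (1ℤ + m) * (1ℤ + m) * Dn - ((+ 2 * m + 1ℤ) * (+ 2 * s + 1ℤ) * Dm + m * m * Dl) ≡
          (- + 2 * (((1ℤ + m) * (1ℤ + m) * Dn - + 3 * (1ℤ + m) * M1n + + 3 * (1ℤ + m) * (s * Dm - M1m)
              - (s * Dm + (s - 1ℤ) * M1m + (- 1ℤ) * M2m))
            - ((1ℤ + s + (+ 2 + s) * m + m * m) * Dm + (- (+ 2 + s + + 2 * m)) * M1m + 1ℤ * M2m))
          + - (+ 3 * (1ℤ + m)) * (+ 2 * M1n - (1ℤ + m) * (Dn - Dm)))
          + - m * (+ 2 * M1m - m * (Dm - Dl))
        l = solve-∀

-- Counting integer vectors with bounded positive and negative parts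

module Counting where

  open import Defs using (HasCardinality)
  open Convolution
  open import Data.Empty using (⊥-elim)
  open import Data.Integer.Base as ℤ using (ℤ; +_; -[1+_]; 0ℤ; -_; _⊖_)
  import Data.Integer.Properties as ℤ
  open import Data.List.Base using ([]; _∷_; _++_; map)
  open import Data.List.Properties using (length-map; length-++)
  open import Data.List.Membership.Propositional.Properties using (∈-map⁺; ∈-map⁻; ++-∈⇔)
  open import Data.List.Membership.Propositional.Properties.WithK using (unique∧set⇒bag)
  open import Data.List.Relation.Binary.BagAndSetEquality using (∼bag⇒↭)
  open import Data.List.Relation.Binary.Permutation.Propositional.Properties using (↭-length)
  open import Data.List.Relation.Unary.Any using (here; there)
  import Data.List.Relation.Unary.All as All
  import Data.List.Relation.Unary.AllPairs as AllPairs
  import Data.List.Relation.Unary.Unique.Propositional.Properties as Unique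
  open import Data.Nat.Base using (ℕ; zero; suc; _+_; _*_; _≤_; z≤n; s≤s; s≤s⁻¹)
  open import Data.Nat.Combinatorics using (_C_; nCn≡1; nCk+nC[k+1]≡[n+1]C[k+1])
  import Data.Nat.Properties as ℕ
  open import Data.Product.Base using (∃-syntax; _×_; _,_; map₁)
  open import Data.Sum.Base as Sum using (_⊎_; inj₁; inj₂)
  open import Data.Vec.Base using (Vec; []; _∷_)
  import Data.Vec.Properties as Vec
  open import Function.Base using (_∘_)
  open import Function.Bundles using (_⇔_; mk⇔; module Equivalence)
  open import Function.Construct.Composition using (_⇔-∘_)
  open import Function.Construct.Symmetry using (⇔-sym)
  open import Level using (0ℓ)
  open import Relation.Binary.PropositionalEquality
  open import Relation.Nullary using (¬_)
  open import Relation.Unary using (Pred)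

  module _ {A : Set} where

    card-unique : ∀ {P : Pred A 0ℓ} {k l} → HasCardinality P k → HasCardinality P l → k ≡ l
    card-unique (xs , xs! , xs⇔P , refl) (ys , ys! , ys⇔P , refl) =
      ↭-length (∼bag⇒↭ (unique∧set⇒bag xs! ys! (λ {x} → ⇔-sym (ys⇔P x) ⇔-∘ xs⇔P x)))

    card-resp : ∀ {P Q : Pred A 0ℓ} {k} → (∀ x → P x ⇔ Q x) → HasCardinality P k → HasCardinality Q k
    card-resp P⇔Q (xs , xs! , xs⇔P , e) = xs , xs! , (λ x → P⇔Q x ⇔-∘ xs⇔P x) , e

    card-empty : ∀ {P : Pred A 0ℓ} → (∀ x → ¬ P x) → HasCardinality P 0
    card-empty ¬P = [] , AllPairs.[] , (λ x → mk⇔ (λ ()) λ Px → ⊥-elim (¬P x Px)) , refl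

    card-singleton : (a : A) → HasCardinality (_≡ a) 1
    card-singleton a = a ∷ [] , All.[] AllPairs.∷ AllPairs.[] ,
      (λ x → mk⇔ (λ { (here e) → e ; (there ()) }) here) , refl

    card-⊎ : ∀ {P Q : Pred A 0ℓ} {k l} → (∀ {x} → P x → ¬ Q x) →
      HasCardinality P k → HasCardinality Q l → HasCardinality (λ x → P x ⊎ Q x) (k + l)
    card-⊎ disjoint (xs , xs! , xs⇔P , refl) (ys , ys! , ys⇔Q , refl) =
      xs ++ ys ,
      Unique.++⁺ xs! ys! (λ { (x∈xs , x∈ys) → disjoint (to (xs⇔P _) x∈xs) (to (ys⇔Q _) x∈ys) }) ,
      (λ x → mk⇔ (Sum.map (to (xs⇔P x)) (to (ys⇔Q x)) ∘ to (++-∈⇔ {xs = xs}))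
                 (from (++-∈⇔ {xs = xs}) ∘ Sum.map (from (xs⇔P x)) (from (ys⇔Q x)))) ,
      length-++ xs
      where open Equivalence

    card-image : ∀ {B : Set} {P : Pred A 0ℓ} {k} (f : A → B) → (∀ {x y} → f x ≡ f y → x ≡ y) →
      HasCardinality P k → HasCardinality (λ b → ∃[ a ] P a × b ≡ f a) k
    card-image f f-inj (xs , xs! , xs⇔P , refl) =
      map f xs , Unique.map⁺ f-inj xs! ,
      (λ b → mk⇔ (λ b∈ → let a , a∈ , e = ∈-map⁻ f b∈ in a , to (xs⇔P a) a∈ , e)
                 (λ { (a , Pa , refl) → ∈-map⁺ f (from (xs⇔P a) Pa) })) ,
      length-map f xs
      where open Equivalence

  -- The cardinality is compared in ℤ because `bin` takes values there, where the moment relations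
  -- can subtract.
  Counted : ∀ {A : Set} → Pred A 0ℓ → ℤ → Set
  Counted P z = ∃[ k ] HasCardinality P k × + k ≡ z

  counted-⊎ : ∀ {A : Set} {P Q R : Pred A 0ℓ} {x y} → (∀ {a} → P a → ¬ Q a) →
    (∀ a → (P a ⊎ Q a) ⇔ R a) → Counted P x → Counted Q y → Counted R (x ℤ.+ y)
  counted-⊎ disjoint iff (k , cardP , refl) (l , cardQ , refl) =
    k + l , card-resp iff (card-⊎ disjoint cardP cardQ) , refl

  counted-image : ∀ {A B : Set} {P : Pred A 0ℓ} {z} (f : A → B) → (∀ {x y} → f x ≡ f y → x ≡ y) →
    Counted P z → Counted (λ b → ∃[ a ] P a × b ≡ f a) z
  counted-image f f-inj (k , cardP , e) = k , card-image f f-inj cardP , e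

  posPart negPart : ℤ → ℕ
  posPart (+ n)    = n
  posPart -[1+ n ] = 0
  negPart (+ n)    = 0
  negPart -[1+ n ] = suc n

  total : ∀ {d} → (ℤ → ℕ) → Vec ℤ d → ℕ
  total f []      = 0
  total f (i ∷ x) = f i + total f x

  pos neg : ∀ {d} → Vec ℤ d → ℕ
  pos = total posPart
  neg = total negPart

  Box : ∀ {d} → ℕ → ℕ → Pred (Vec ℤ d) 0ℓ
  Box a b x = pos x ≤ a × neg x ≤ b

  -- The vectors of Box a b with first entry 1 + t, respectively - t, encoded
  -- as the pair of t and the remaining entries.
  PosBox NegBox : ∀ {d} → ℕ → ℕ → Pred (ℕ × Vec ℤ d) 0ℓ
  PosBox a b (t , x) = suc t + pos x ≤ a × neg x ≤ b
  NegBox a b (t , x) = pos x ≤ a × t + neg x ≤ b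

  posPart-negate : ∀ t → posPart (- + t) ≡ 0
  posPart-negate zero    = refl
  posPart-negate (suc t) = refl

  negPart-negate : ∀ t → negPart (- + t) ≡ t
  negPart-negate zero    = refl
  negPart-negate (suc t) = refl

  bin-0 : ∀ d {f : ℕ → ℕ → ℤ} → (∀ p q → f p q ≡ 0ℤ) → bin d f ≡ 0ℤ
  bin-0 zero    f≡0 = f≡0 0 0
  bin-0 (suc d) f≡0 = cong₂ ℤ._+_ (bin-0 d λ p q → f≡0 (suc p) q) (bin-0 d λ p q → f≡0 p (suc q))

  module _ {d : ℕ} (box : ∀ a b → Counted (Box {d} a b) (bin d (count a b))) where

    private
      first : Vec ℤ d → ℕ × Vec ℤ d
      first x = 0 , x

      shift : ℕ × Vec ℤ d → ℕ × Vec ℤ d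
      shift = map₁ suc

      first-injective : ∀ {x y} → first x ≡ first y → x ≡ y
      first-injective refl = refl

      shift-injective : ∀ {x y} → shift x ≡ shift y → x ≡ y
      shift-injective refl = refl

      disjoint : ∀ {P : Pred (Vec ℤ d) 0ℓ} {Q : Pred (ℕ × Vec ℤ d) 0ℓ} {a} →
        (∃[ x ] P x × a ≡ first x) → ¬ (∃[ y ] Q y × a ≡ shift y)
      disjoint (_ , _ , refl) (_ , _ , ())

    -- If the first entry is 1, the rest may use the whole remaining allowance; otherwise the entry
    -- can be lowered by 1 together with a. These two cases are the two terms of Pascal's rule for
    -- (a+1 choose p+1).
    posBox : ∀ a b → Counted (PosBox a b) (bin d (λ p q → count a b (suc p) q))
    posBox zero    b = 0 , card-empty (λ _ ()) , sym (bin-0 d λ p q → refl)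
    posBox (suc a) b = subst (Counted _)
      (trans (sym (bin-+ d _ _)) (bin-cong d _ _ λ p q _ → cong +_ (pascal p q)))
      (counted-⊎ disjoint (λ x → mk⇔ (to x) (from x))
        (counted-image first first-injective (box a b))
        (counted-image shift shift-injective (posBox a b)))
      where
      pascal : ∀ p q → (a C p) * ((b + q) C q) + (a C suc p) * ((b + q) C q) ≡ (suc a C suc p) * ((b + q) C q)
      pascal p q = trans (sym (ℕ.*-distribʳ-+ _ (a C p) (a C suc p)))
        (cong (_* ((b + q) C q)) (nCk+nC[k+1]≡[n+1]C[k+1] a p))
      to : ∀ x → (∃[ y ] Box a b y × x ≡ first y) ⊎ (∃[ y ] PosBox a b y × x ≡ shift y) → PosBox (suc a) b x
      to _ (inj₁ (_ , (h , k) , refl)) = s≤s h , k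
      to _ (inj₂ (_ , (h , k) , refl)) = s≤s h , k
      from : ∀ x → PosBox (suc a) b x → (∃[ y ] Box a b y × x ≡ first y) ⊎ (∃[ y ] PosBox a b y × x ≡ shift y)
      from (zero  , x) (h , k) = inj₁ (x , (s≤s⁻¹ h , k) , refl)
      from (suc t , x) (h , k) = inj₂ ((t , x) , (s≤s⁻¹ h , k) , refl)

    -- The same split on t. Since t may be 0, the allowance b = 0 leaves the vectors with first
    -- entry 0 instead of none, and the step is Pascal's rule for (b+q+2 choose q+1); hence (b+q
    -- choose q) in `count` against (a choose p).
    negBox : ∀ a b → Counted (NegBox a b) (bin d (λ p q → count a b p (suc q)))
    negBox a zero = let k , card , e = counted-image first first-injective (box a 0) in
      k , card-resp (λ x → mk⇔ (to x) (from x)) card ,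
      trans e (bin-cong d _ _ λ p q _ → cong (λ c → + ((a C p) * c)) (trans (nCn≡1 q) (sym (nCn≡1 (suc q)))))
      where
      to : ∀ x → (∃[ y ] Box a 0 y × x ≡ first y) → NegBox a 0 x
      to _ (_ , h , refl) = h
      from : ∀ x → NegBox a 0 x → (∃[ y ] Box a 0 y × x ≡ first y)
      from (zero , x) h = x , h , refl
    negBox a (suc b) = subst (Counted _)
      (trans (sym (bin-+ d _ _)) (bin-cong d _ _ λ p q _ → cong +_ (pascal p q)))
      (counted-⊎ disjoint (λ x → mk⇔ (to x) (from x))
        (counted-image first first-injective (box a (suc b)))
        (counted-image shift shift-injective (negBox a b)))
      where
      pascal : ∀ p q → (a C p) * ((suc b + q) C q) + (a C p) * ((b + suc q) C suc q) ≡ (a C p) * ((suc b + suc q) C suc q)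
      pascal p q = trans (sym (ℕ.*-distribˡ-+ (a C p) _ _)) (cong ((a C p) *_)
        (trans (cong (λ n → (n C q) + ((b + suc q) C suc q)) (sym (ℕ.+-suc b q)))
          (nCk+nC[k+1]≡[n+1]C[k+1] (b + suc q) q)))
      to : ∀ x → (∃[ y ] Box a (suc b) y × x ≡ first y) ⊎ (∃[ y ] NegBox a b y × x ≡ shift y) → NegBox a (suc b) x
      to _ (inj₁ (_ , (h , k) , refl)) = h , k
      to _ (inj₂ (_ , (h , k) , refl)) = h , s≤s k
      from : ∀ x → NegBox a (suc b) x → (∃[ y ] Box a (suc b) y × x ≡ first y) ⊎ (∃[ y ] NegBox a b y × x ≡ shift y)
      from (zero  , x) (h , k) = inj₁ (x , (h , k) , refl)
      from (suc t , x) (h , k) = inj₂ ((t , x) , (h , s≤s⁻¹ k) , refl)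

  -- The sign of the first entry selects one of the two halves of `bin (suc d)`. An entry 0 goes
  -- with the negative ones, so that the cases are disjoint.
  box : ∀ d a b → Counted (Box {d} a b) (bin d (count a b))
  box zero a b = 1 , card-resp (λ { [] → mk⇔ (λ _ → z≤n , z≤n) (λ _ → refl) }) (card-singleton []) ,
    cong +_ (sym (ℕ.*-identityˡ 1))
  box (suc d) a b = counted-⊎ disjoint (λ x → mk⇔ (to x) (from x))
    (counted-image cons⁺ cons⁺-injective (posBox (box d) a b))
    (counted-image cons⁻ cons⁻-injective (negBox (box d) a b))
    where
    cons⁺ cons⁻ : ℕ × Vec ℤ d → Vec ℤ (suc d)
    cons⁺ (t , x) = + suc t ∷ x
    cons⁻ (t , x) = - + t ∷ x
    cons⁺-injective : ∀ {x y} → cons⁺ x ≡ cons⁺ y → x ≡ y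
    cons⁺-injective refl = refl
    cons⁻-injective : ∀ {x y} → cons⁻ x ≡ cons⁻ y → x ≡ y
    cons⁻-injective {t , _} {u , _} e = cong₂ _,_
      (ℤ.+-injective (ℤ.neg-injective (Vec.∷-injectiveˡ e))) (Vec.∷-injectiveʳ e)
    disjoint : ∀ {x} → (∃[ y ] PosBox a b y × x ≡ cons⁺ y) → ¬ (∃[ y ] NegBox a b y × x ≡ cons⁻ y)
    disjoint (_ , _ , refl) ((zero , _) , _ , ())
    disjoint (_ , _ , refl) ((suc _ , _) , _ , ())
    to : ∀ x → (∃[ y ] PosBox a b y × x ≡ cons⁺ y) ⊎ (∃[ y ] NegBox a b y × x ≡ cons⁻ y) → Box a b x
    to _ (inj₁ (_ , h , refl)) = h
    to _ (inj₂ ((t , x) , (h , k) , refl)) =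
      subst (λ n → n + pos x ≤ a) (sym (posPart-negate t)) h ,
      subst (λ n → n + neg x ≤ b) (sym (negPart-negate t)) k
    from : ∀ x → Box a b x → (∃[ y ] PosBox a b y × x ≡ cons⁺ y) ⊎ (∃[ y ] NegBox a b y × x ≡ cons⁻ y)
    from (+ zero   ∷ x) h = inj₂ ((0 , x) , h , refl)
    from (+ suc t  ∷ x) h = inj₁ ((t , x) , h , refl)
    from (-[1+ t ] ∷ x) h = inj₂ ((suc t , x) , h , refl)

  -- Balanced vectors have sum 0, so their first entry can be recovered from the others.
  Balanced : ∀ {n} → ℕ → Pred (Vec ℤ n) 0ℓ
  Balanced s x = pos x ≡ neg x × pos x ≤ s

  balance : ∀ {d} → Vec ℤ d → Vec ℤ (suc d)
  balance x = neg x ⊖ pos x ∷ x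

  posPart-⊖ : ∀ m n → posPart (m ⊖ n) + n ≡ negPart (m ⊖ n) + m
  posPart-⊖ zero    zero    = refl
  posPart-⊖ zero    (suc n) = sym (ℕ.+-identityʳ _)
  posPart-⊖ (suc m) zero    = ℕ.+-identityʳ _
  posPart-⊖ (suc m) (suc n) rewrite ℤ.[1+m]⊖[1+n]≡m⊖n m n =
    trans (ℕ.+-suc (posPart (m ⊖ n)) n) (trans (cong suc (posPart-⊖ m n)) (sym (ℕ.+-suc (negPart (m ⊖ n)) m)))

  -- The left side is the maximum of m and n. Hence adding the balancing entry makes the positive
  -- part max (pos y) (neg y), and the single bound by s on it amounts to the two bounds of
  -- `Box s s`.
  posPart-⊖-bound : ∀ m n {s} → m ≤ s → n ≤ s → posPart (m ⊖ n) + n ≤ s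
  posPart-⊖-bound zero    zero    m≤s n≤s = n≤s
  posPart-⊖-bound zero    (suc n) m≤s n≤s = n≤s
  posPart-⊖-bound (suc m) zero    {s} m≤s n≤s = subst (_≤ s) (sym (ℕ.+-identityʳ (suc m))) m≤s
  posPart-⊖-bound (suc m) (suc n) {suc s} m≤s n≤s rewrite ℤ.[1+m]⊖[1+n]≡m⊖n m n =
    subst (_≤ suc s) (sym (ℕ.+-suc (posPart (m ⊖ n)) n)) (s≤s (posPart-⊖-bound m n (s≤s⁻¹ m≤s) (s≤s⁻¹ n≤s)))

  balance-unique : ∀ i m n → posPart i + n ≡ negPart i + m → i ≡ m ⊖ n
  balance-unique (+ k)    m n refl = sym (trans (ℤ.⊖-≥ (ℕ.m≤n+m n k)) (cong +_ (ℕ.m+n∸n≡m k n)))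
  balance-unique -[1+ k ] m n refl = sym (trans (ℤ.⊖-≤ (ℕ.m≤n+m m (suc k))) (cong (λ l → - + l) (ℕ.m+n∸n≡m (suc k) m)))

  balanced : ∀ d s → Counted (Balanced {suc d} s) (bin d (count s s))
  balanced d s = let k , card , e = counted-image balance Vec.∷-injectiveʳ (box d s s) in
    k , card-resp (λ x → mk⇔ (to x) (from x)) card , e
    where
    to : ∀ x → (∃[ y ] Box s s y × x ≡ balance y) → Balanced s x
    to _ (y , (h , k) , refl) = posPart-⊖ (neg y) (pos y) , posPart-⊖-bound (neg y) (pos y) k h
    from : ∀ x → Balanced s x → ∃[ y ] Box s s y × x ≡ balance y
    from (i ∷ y) (e , h) =
      y , (ℕ.≤-trans (ℕ.m≤n+m (pos y) (posPart i)) h ,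
           ℕ.≤-trans (ℕ.m≤n+m (neg y) (negPart i)) (subst (_≤ s) e h)) ,
      cong (_∷ y) (balance-unique i (neg y) (pos y) e)

-- Limits of rational sequences

module Sequences where

  open import Data.Integer.Base as ℤ using (ℤ)
  import Data.Integer.Properties as ℤ
  open import Data.Maybe.Base using (Maybe; just; nothing)
  open import Data.Fin.Base using (Fin; zero; suc)
  open import Data.Nat.Base as ℕ using (ℕ; zero; suc)
  import Data.Nat.Properties as ℕ
  open import Data.Product.Base using (∃-syntax; _×_; _,_)
  import Data.Nat.Coprimality as Coprime
  open import Data.Rational.Base using (ℚ; mkℚ; _/_; *≤*; 0ℚ; 1ℚ; ½; ∣_∣; 1/_; _+_; _*_; _-_; -_; _<_; _≤_; Positive; NonNegative; NonZero; positive; nonNegative)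
  open import Data.Rational.Properties
  open import Data.Sum.Base using (inj₁; inj₂)
  open import Algebra.Bundles using (module CommutativeRing)
  open import Algebra.Properties.Semiring.Sum (CommutativeRing.semiring +-*-commutativeRing) public
    using (∑-comm; ∑-distrib-+; *-distribˡ-sum; sum-cong-≗) renaming (sum to ∑)
  open import Relation.Binary.PropositionalEquality
  open import Relation.Nullary using (yes; no)
  open import Tactic.RingSolver using (solve-∀)
  open import Tactic.RingSolver.Core.AlmostCommutativeRing using (AlmostCommutativeRing; fromCommutativeRing)

  ℚ-ring : AlmostCommutativeRing _ _
  ℚ-ring = fromCommutativeRing +-*-commutativeRing zero?
    where
    zero? : ∀ x → Maybe (0ℚ ≡ x)
    zero? x with 0ℚ ≟ x
    ... | yes e = just e
    ... | no  _ = nothing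

  Seq : Set
  Seq = ℕ → ℚ

  Eventually : (ℕ → Set) → Set
  Eventually P = ∃[ N ] (∀ n → N ℕ.≤ n → P n)

  both : ∀ {P Q R : ℕ → Set} → (∀ n → P n → Q n → R n) → Eventually P → Eventually Q → Eventually R
  both f (M , hM) (N , hN) = M ℕ.⊔ N , λ n le →
    f n (hM n (ℕ.≤-trans (ℕ.m≤m⊔n M N) le)) (hN n (ℕ.≤-trans (ℕ.m≤n⊔m M N) le))

  eventually : ∀ {P Q : ℕ → Set} → (∀ n → P n → Q n) → Eventually P → Eventually Q
  eventually f (N , h) = N , λ n le → f n (h n le)

  -- For the difference of two sequences, `Null` and `NonPos` are what `_≈_` and `_≤_` on ℝ unfold
  -- to. Statements about reals thus become statements about rational sequences, and the Cauchy
  -- property enters only through `Bounded`.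
  Null NonPos Bounded : Seq → Set
  Null x    = ∀ ε → 0ℚ < ε → Eventually λ n → ∣ x n ∣ < ε
  NonPos x  = ∀ ε → 0ℚ < ε → Eventually λ n → x n < ε
  Bounded x = ∃[ B ] Positive B × Eventually λ n → ∣ x n ∣ ≤ B

  0<½* : ∀ ε → 0ℚ < ε → 0ℚ < ½ * ε
  0<½* ε 0<ε = positive⁻¹ (½ * ε) {{pos*pos⇒pos ½ ε {{positive 0<ε}}}}

  ½+½ : ∀ ε → ½ * ε + ½ * ε ≡ ε
  ½+½ ε = trans (sym (*-distribʳ-+ ε ½ ½)) (*-identityˡ ε)

  p≤∣p∣ : ∀ p → p ≤ ∣ p ∣
  p≤∣p∣ p with ≤-total 0ℚ p
  ... | inj₁ 0≤p = ≤-reflexive (sym (0≤p⇒∣p∣≡p 0≤p))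
  ... | inj₂ p≤0 = ≤-trans p≤0 (0≤∣p∣ p)

  null-≤ : ∀ (x y : Seq) → (∀ n → ∣ x n ∣ ≤ ∣ y n ∣) → Null y → Null x
  null-≤ x y x≤y null-y ε 0<ε = eventually (λ n h → ≤-<-trans (x≤y n) h) (null-y ε 0<ε)

  null-resp : ∀ (x y : Seq) → (∀ n → x n ≡ y n) → Null x → Null y
  null-resp x y e = null-≤ y x λ n → ≤-reflexive (cong ∣_∣ (sym (e n)))

  null-0 : Null (λ _ → 0ℚ)
  null-0 ε 0<ε = 0 , λ _ _ → 0<ε

  null-+ : ∀ (x y : Seq) → Null x → Null y → Null (λ n → x n + y n)
  null-+ x y null-x null-y ε 0<ε = both
    (λ n h k → ≤-<-trans (∣p+q∣≤∣p∣+∣q∣ (x n) (y n)) (subst (_ <_) (½+½ ε) (+-mono-< h k)))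
    (null-x (½ * ε) (0<½* ε 0<ε)) (null-y (½ * ε) (0<½* ε 0<ε))

  null-neg : ∀ (x : Seq) → Null x → Null (λ n → - x n)
  null-neg x = null-≤ (λ n → - x n) x λ n → ≤-reflexive (∣-p∣≡∣p∣ (x n))

  null-* : ∀ (b x : Seq) → Bounded b → Null x → Null (λ n → b n * x n)
  null-* b x (B , B⁺ , b≤B) null-x ε 0<ε = both
    (λ n h k → begin-strict
      ∣ b n * x n ∣       ≡⟨ ∣p*q∣≡∣p∣*∣q∣ (b n) (x n) ⟩
      ∣ b n ∣ * ∣ x n ∣   ≤⟨ *-monoʳ-≤-nonNeg ∣ x n ∣ {{∣-∣-nonNeg (x n)}} h ⟩
      B * ∣ x n ∣         <⟨ *-monoʳ-<-pos B k ⟩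
      B * (1/ B * ε)      ≡⟨ *-assoc B (1/ B) ε ⟨
      (B * 1/ B) * ε      ≡⟨ cong (_* ε) (*-inverseʳ B) ⟩
      1ℚ * ε              ≡⟨ *-identityˡ ε ⟩
      ε                   ∎)
    b≤B (null-x (1/ B * ε) (positive⁻¹ (1/ B * ε) {{pos*pos⇒pos (1/ B) {{1/pos⇒pos B}} ε {{positive 0<ε}}}}))
    where
    open ≤-Reasoning
    instance
      B-positive = B⁺
      B-nonZero = pos⇒nonZero B

  bounded-const : ∀ q → Bounded (λ _ → q)
  bounded-const q = 1ℚ + ∣ q ∣ , pos+nonNeg⇒pos 1ℚ ∣ q ∣ {{∣-∣-nonNeg q}} , 0 , λ _ _ →
    subst (_≤ 1ℚ + ∣ q ∣) (+-identityˡ ∣ q ∣) (+-monoˡ-≤ ∣ q ∣ (nonNegative⁻¹ 1ℚ))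

  bounded-+ : ∀ (x y : Seq) → Bounded x → Bounded y → Bounded (λ n → x n + y n)
  bounded-+ x y (B , B⁺ , h) (C , C⁺ , k) = B + C , pos+pos⇒pos B {{B⁺}} C {{C⁺}} ,
    both (λ n p q → ≤-trans (∣p+q∣≤∣p∣+∣q∣ (x n) (y n)) (+-mono-≤ p q)) h k

  bounded-neg : ∀ (x : Seq) → Bounded x → Bounded (λ n → - x n)
  bounded-neg x (B , B⁺ , h) = B , B⁺ , eventually (λ n p → ≤-trans (≤-reflexive (∣-p∣≡∣p∣ (x n))) p) h

  bounded-* : ∀ (x y : Seq) → Bounded x → Bounded y → Bounded (λ n → x n * y n)
  bounded-* x y (B , B⁺ , h) (C , C⁺ , k) = B * C , pos*pos⇒pos B {{B⁺}} C {{C⁺}} , both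
    (λ n p q → begin
      ∣ x n * y n ∣      ≡⟨ ∣p*q∣≡∣p∣*∣q∣ (x n) (y n) ⟩
      ∣ x n ∣ * ∣ y n ∣  ≤⟨ *-monoʳ-≤-nonNeg ∣ y n ∣ {{∣-∣-nonNeg (y n)}} p ⟩
      B * ∣ y n ∣        ≤⟨ *-monoˡ-≤-nonNeg B {{pos⇒nonNeg B {{B⁺}}}} q ⟩
      B * C              ∎)
    h k
    where open ≤-Reasoning

  bounded-cauchy : ∀ (x : Seq) →
    (∀ ε → 0ℚ < ε → ∃[ N ] (∀ m n → N ℕ.≤ m → N ℕ.≤ n → ∣ x m - x n ∣ < ε)) → Bounded x
  bounded-cauchy x cauchy with cauchy 1ℚ (positive⁻¹ 1ℚ)
  ... | N , h = 1ℚ + ∣ x N ∣ , pos+nonNeg⇒pos 1ℚ ∣ x N ∣ {{∣-∣-nonNeg (x N)}} , N , λ n N≤n → begin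
    ∣ x n ∣                    ≡⟨ cong ∣_∣ (lemma (x n) (x N)) ⟩
    ∣ (x n - x N) + x N ∣      ≤⟨ ∣p+q∣≤∣p∣+∣q∣ (x n - x N) (x N) ⟩
    ∣ x n - x N ∣ + ∣ x N ∣    ≤⟨ +-monoˡ-≤ ∣ x N ∣ (<⇒≤ (h n N N≤n ℕ.≤-refl)) ⟩
    1ℚ + ∣ x N ∣               ∎
    where
    open ≤-Reasoning
    lemma : ∀ a b → a ≡ (a - b) + b
    lemma = solve-∀ ℚ-ring

  null⇒nonPos : ∀ (x : Seq) → Null x → NonPos x
  null⇒nonPos x null-x ε 0<ε = eventually (λ n → ≤-<-trans (p≤∣p∣ (x n))) (null-x ε 0<ε)

  nonPos-resp : ∀ (x y : Seq) → (∀ n → x n ≡ y n) → NonPos x → NonPos y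
  nonPos-resp x y e h ε 0<ε = eventually (λ n → subst (_< ε) (e n)) (h ε 0<ε)

  nonPos-+ : ∀ (x y : Seq) → NonPos x → NonPos y → NonPos (λ n → x n + y n)
  nonPos-+ x y h k ε 0<ε = both (λ n p q → subst (_ <_) (½+½ ε) (+-mono-< p q))
    (h (½ * ε) (0<½* ε 0<ε)) (k (½ * ε) (0<½* ε 0<ε))

  -- Dividing ε by 1 + c avoids a case distinction on c = 0.
  nonPos-* : ∀ c (x : Seq) → 0ℚ ≤ c → NonPos x → NonPos (λ n → c * x n)
  nonPos-* c x 0≤c h ε 0<ε = eventually
    (λ n p → begin-strict
      c * x n                    ≤⟨ *-monoˡ-≤-nonNeg c (<⇒≤ p) ⟩
      c * (1/ d * ε)             <⟨ *-monoˡ-<-pos (1/ d * ε) c<d ⟩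
      d * (1/ d * ε)             ≡⟨ *-assoc d (1/ d) ε ⟨
      (d * 1/ d) * ε             ≡⟨ cong (_* ε) (*-inverseʳ d) ⟩
      1ℚ * ε                     ≡⟨ *-identityˡ ε ⟩
      ε                          ∎)
    (h (1/ d * ε) (positive⁻¹ (1/ d * ε)))
    where
    open ≤-Reasoning
    d = 1ℚ + c
    instance
      c-nonNeg : NonNegative c
      c-nonNeg = nonNegative 0≤c
      d-pos : Positive d
      d-pos = pos+nonNeg⇒pos 1ℚ c
      d-nonZero = pos⇒nonZero d
      δ-pos : Positive (1/ d * ε)
      δ-pos = pos*pos⇒pos (1/ d) {{1/pos⇒pos d}} ε {{positive 0<ε}}
    c<d : c < d
    c<d = subst (_< d) (+-identityˡ c) (+-monoˡ-< c (positive⁻¹ 1ℚ))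

  nonPos-const : ∀ q → NonPos (λ _ → q) → q ≤ 0ℚ
  nonPos-const q h = ≮⇒≥ λ 0<q → let N , k = h q 0<q in <-irrefl refl (k N ℕ.≤-refl)

  infix 4 _~_
  _~_ : Seq → Seq → Set
  x ~ y = Null (λ n → x n - y n)

  ~-resp : ∀ {x x′ y y′ : Seq} → (∀ n → x n ≡ x′ n) → (∀ n → y n ≡ y′ n) → x ~ y → x′ ~ y′
  ~-resp {x} {x′} {y} {y′} e f = null-resp (λ n → x n - y n) (λ n → x′ n - y′ n) λ n → cong₂ _-_ (e n) (f n)

  ~-reflexive : ∀ {x y : Seq} → (∀ n → x n ≡ y n) → x ~ y
  ~-reflexive {x} {y} e = null-resp (λ _ → 0ℚ) (λ n → x n - y n)
    (λ n → sym (trans (cong (_- y n) (e n)) (+-inverseʳ (y n)))) null-0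

  ~-trans : ∀ {x y z : Seq} → x ~ y → y ~ z → x ~ z
  ~-trans {x} {y} {z} h k = null-resp (λ n → (x n - y n) + (y n - z n)) (λ n → x n - z n)
    (λ n → lemma (x n) (y n) (z n)) (null-+ (λ n → x n - y n) (λ n → y n - z n) h k)
    where
    lemma : ∀ a b c → (a - b) + (b - c) ≡ a - c
    lemma = solve-∀ ℚ-ring

  ~-* : ∀ {b x y : Seq} → Bounded b → x ~ y → (λ n → b n * x n) ~ (λ n → b n * y n)
  ~-* {b} {x} {y} bdd h = null-resp (λ n → b n * (x n - y n)) (λ n → b n * x n - b n * y n)
    (λ n → lemma (b n) (x n) (y n)) (null-* b (λ n → x n - y n) bdd h)
    where
    lemma : ∀ a b c → a * (b - c) ≡ a * b - a * c
    lemma = solve-∀ ℚ-ring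

  ~-+ : ∀ {x x′ y y′ : Seq} → x ~ x′ → y ~ y′ → (λ n → x n + y n) ~ (λ n → x′ n + y′ n)
  ~-+ {x} {x′} {y} {y′} h k = null-resp (λ n → (x n - x′ n) + (y n - y′ n)) (λ n → (x n + y n) - (x′ n + y′ n))
    (λ n → lemma (x n) (x′ n) (y n) (y′ n)) (null-+ (λ n → x n - x′ n) (λ n → y n - y′ n) h k)
    where
    lemma : ∀ a b c d → (a - b) + (c - d) ≡ (a + c) - (b + d)
    lemma = solve-∀ ℚ-ring

  ~-∑ : ∀ {k} {f g : Fin k → Seq} → (∀ j → f j ~ g j) → (λ n → ∑ λ j → f j n) ~ (λ n → ∑ λ j → g j n)
  ~-∑ {zero}  h = null-0
  ~-∑ {suc k} {f} {g} h = ~-+ {f zero} {g zero} (h zero) (~-∑ {k} {λ j → f (suc j)} {λ j → g (suc j)} λ j → h (suc j))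

  infix 4 _≲_
  _≲_ : Seq → Seq → Set
  x ≲ y = NonPos (λ n → x n - y n)

  ~⇒≲ : ∀ {x y : Seq} → x ~ y → x ≲ y
  ~⇒≲ {x} {y} = null⇒nonPos (λ n → x n - y n)

  ≲-trans : ∀ {x y z : Seq} → x ≲ y → y ≲ z → x ≲ z
  ≲-trans {x} {y} {z} h k = nonPos-resp (λ n → (x n - y n) + (y n - z n)) (λ n → x n - z n)
    (λ n → lemma (x n) (y n) (z n)) (nonPos-+ (λ n → x n - y n) (λ n → y n - z n) h k)
    where
    lemma : ∀ a b c → (a - b) + (b - c) ≡ a - c
    lemma = solve-∀ ℚ-ring

  ≲-+ : ∀ {x x′ y y′ : Seq} → x ≲ x′ → y ≲ y′ → (λ n → x n + y n) ≲ (λ n → x′ n + y′ n)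
  ≲-+ {x} {x′} {y} {y′} h k = nonPos-resp (λ n → (x n - x′ n) + (y n - y′ n)) (λ n → (x n + y n) - (x′ n + y′ n))
    (λ n → lemma (x n) (x′ n) (y n) (y′ n)) (nonPos-+ (λ n → x n - x′ n) (λ n → y n - y′ n) h k)
    where
    lemma : ∀ a b c d → (a - b) + (c - d) ≡ (a + c) - (b + d)
    lemma = solve-∀ ℚ-ring

  ≲-* : ∀ {c} {x y : Seq} → 0ℚ ≤ c → x ≲ y → (λ n → c * x n) ≲ (λ n → c * y n)
  ≲-* {c} {x} {y} 0≤c h = nonPos-resp (λ n → c * (x n - y n)) (λ n → c * x n - c * y n)
    (λ n → lemma c (x n) (y n)) (nonPos-* c (λ n → x n - y n) 0≤c h)
    where
    lemma : ∀ a b c → a * (b - c) ≡ a * b - a * c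
    lemma = solve-∀ ℚ-ring

  ≲-∑ : ∀ {k} {f g : Fin k → Seq} → (∀ j → f j ≲ g j) → (λ n → ∑ λ j → f j n) ≲ (λ n → ∑ λ j → g j n)
  ≲-∑ {zero}  h = null⇒nonPos (λ _ → 0ℚ) null-0
  ≲-∑ {suc k} {f} {g} h = ≲-+ {f zero} {g zero} (h zero) (≲-∑ {k} {λ j → f (suc j)} {λ j → g (suc j)} λ j → h (suc j))

  ≤⇒≲ : ∀ {p q} → p ≤ q → (λ _ → p) ≲ (λ _ → q)
  ≤⇒≲ {p} {q} p≤q ε 0<ε = 0 , λ _ _ →
    ≤-<-trans (subst (p - q ≤_) (+-inverseʳ q) (+-monoˡ-≤ (- q) p≤q)) 0<ε

  ≲-const : ∀ {p q} → (λ _ → p) ≲ (λ _ → q) → p ≤ q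
  ≲-const {p} {q} h = subst₂ _≤_ (lemma p q) (+-identityˡ q) (+-monoˡ-≤ q (nonPos-const (p - q) h))
    where
    lemma : ∀ a b → (a - b) + b ≡ a
    lemma = solve-∀ ℚ-ring

  ι : ℤ → ℚ
  ι i = i / 1

  -- `i / 1` is normalised through a gcd that is stuck on a variable i; the explicit fraction with
  -- denominator 1 lets sums, products and comparisons reduce to those of ℤ.
  ι-mkℚ : ∀ i → ι i ≡ mkℚ i 0 (Coprime.sym (Coprime.1-coprimeTo ℤ.∣ i ∣))
  ι-mkℚ i = ↥p/↧p≡p (mkℚ i 0 (Coprime.sym (Coprime.1-coprimeTo ℤ.∣ i ∣)))

  ι-+ : ∀ i j → ι (i ℤ.+ j) ≡ ι i + ι j
  ι-+ i j = sym (trans (cong₂ _+_ (ι-mkℚ i) (ι-mkℚ j))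
    (cong ι (cong₂ ℤ._+_ (ℤ.*-identityʳ i) (ℤ.*-identityʳ j))))

  ι-* : ∀ i j → ι (i ℤ.* j) ≡ ι i * ι j
  ι-* i j = sym (cong₂ _*_ (ι-mkℚ i) (ι-mkℚ j))

  ι-mono : ∀ {i j} → i ℤ.≤ j → ι i ≤ ι j
  ι-mono {i} {j} i≤j = subst₂ _≤_ (sym (ι-mkℚ i)) (sym (ι-mkℚ j))
    (*≤* (subst₂ ℤ._≤_ (sym (ℤ.*-identityʳ i)) (sym (ℤ.*-identityʳ j)) i≤j))

  ι-cancel : ∀ {i j} → ι i ≤ ι j → i ℤ.≤ j
  ι-cancel {i} {j} h = subst₂ ℤ._≤_ (ℤ.*-identityʳ i) (ℤ.*-identityʳ j)
    (drop-*≤* (subst₂ _≤_ (ι-mkℚ i) (ι-mkℚ j) h))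

  reciprocal : ∀ k → ∃[ r ] 0ℚ ≤ r × ι (ℤ.+ suc k) * r ≡ 1ℚ
  reciprocal k = 1/ ι (ℤ.+ suc k) ,
    nonNegative⁻¹ (1/ ι (ℤ.+ suc k)) {{pos⇒nonNeg (1/ ι (ℤ.+ suc k)) {{1/pos⇒pos (ι (ℤ.+ suc k)) {{positive-k}}}}}} ,
    *-inverseʳ (ι (ℤ.+ suc k)) {{nonZero-k}}
    where
    instance
      positive-k : Positive (ι (ℤ.+ suc k))
      positive-k = normalize-pos (suc k) 1
      nonZero-k : NonZero (ι (ℤ.+ suc k))
      nonZero-k = pos⇒nonZero (ι (ℤ.+ suc k)) {{positive-k}}

-- Lattice points of the dilated polytope are balanced

module Hull where

  import Defs
  open Defs using (ℝ; seq; cauchy; fromℕ; basis; LatticePoint; dilate; symmetricEdgePolytope; completeGraph)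
  open Counting using (pos; neg; posPart; negPart; Balanced)
  open Sequences
  open import Data.Bool.Base using (true; false; if_then_else_)
  open import Data.Fin.Base using (Fin; zero; suc)
  open import Data.Fin.Properties using (_≟_)
  open import Data.Integer.Base as ℤ using (ℤ; -[1+_])
  import Data.Integer.Properties as ℤ
  import Data.Integer.Tactic.RingSolver as ℤ-Solver
  open import Data.Nat.Base as ℕ using (ℕ; zero; suc)
  import Data.Nat.Properties as ℕ
  open import Data.Product.Base using (_,_)
  open import Data.Rational.Base using (ℚ; 0ℚ; 1ℚ; _+_; _*_; _-_; -_; _≤_)
  open import Data.Rational.Properties hiding (_≟_)
  open import Data.Sum.Base using (inj₁; inj₂)
  open import Data.Vec.Base using (Vec; []; _∷_; lookup)
  open import Data.Vec.Functional using (Vector)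
  open import Relation.Binary.PropositionalEquality
  open import Relation.Nullary using (does)
  open import Tactic.RingSolver using (solve-∀)

  δ : ∀ {n} → Fin n → Fin n → ℚ
  δ u i = if does (u ≟ i) then 1ℚ else 0ℚ

  seq-basis : ∀ {n} (u i : Fin n) k → seq (basis u i) k ≡ δ u i
  seq-basis u i k with does (u ≟ i)
  ... | true  = refl
  ... | false = refl

  seq-sum : ∀ {m} (x : Vector ℝ m) k → seq (Defs.sum x) k ≡ ∑ λ j → seq (x j) k
  seq-sum {zero}  x k = refl
  seq-sum {suc m} x k = cong (seq (x zero) k +_) (seq-sum (λ j → x (suc j)) k)

  ∑-zero : ∀ n → ∑ {n} (λ _ → 0ℚ) ≡ 0ℚ
  ∑-zero zero    = refl
  ∑-zero (suc n) = trans (+-identityˡ _) (∑-zero n)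

  ∑-δ : ∀ {n} (t : Fin n → ℚ) u → ∑ (λ i → t i * δ u i) ≡ t u
  ∑-δ {suc n} t zero = trans (cong₂ _+_ (*-identityʳ (t zero))
      (trans (sum-cong-≗ {n} λ i → *-zeroʳ (t (suc i))) (∑-zero n)))
    (+-identityʳ (t zero))
  ∑-δ {suc n} t (suc u) = trans (cong₂ _+_ (*-zeroʳ (t zero)) (∑-δ (λ i → t (suc i)) u)) (+-identityˡ (t (suc u)))

  ∑-neg : ∀ {n} (f : Fin n → ℚ) → ∑ (λ i → - f i) ≡ - ∑ f
  ∑-neg {zero}  f = refl
  ∑-neg {suc n} f = trans (cong (- f zero +_) (∑-neg (λ i → f (suc i)))) (sym (neg-distrib-+ (f zero) (∑ λ i → f (suc i))))

  ∑-δ-δ : ∀ {n} (t : Fin n → ℚ) u v → ∑ (λ i → t i * (δ u i - δ v i)) ≡ t u - t v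
  ∑-δ-δ t u v = begin
    ∑ (λ i → t i * (δ u i - δ v i))                   ≡⟨ sum-cong-≗ (λ i → lemma (t i) (δ u i) (δ v i)) ⟩
    ∑ (λ i → t i * δ u i + - (t i * δ v i))           ≡⟨ ∑-distrib-+ (λ i → t i * δ u i) (λ i → - (t i * δ v i)) ⟩
    ∑ (λ i → t i * δ u i) + ∑ (λ i → - (t i * δ v i)) ≡⟨ cong₂ _+_ (∑-δ t u) (trans (∑-neg (λ i → t i * δ v i)) (cong -_ (∑-δ t v))) ⟩
    t u - t v                                         ∎
    where
    open ≡-Reasoning
    lemma : ∀ a b c → a * (b - c) ≡ a * b + - (a * c)
    lemma = solve-∀ ℚ-ring

  edge-functional : ∀ {n} (t : Fin n → ℚ) (x : Vector ℝ n) u v →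
    (∀ i → seq (x i) ~ (λ k → seq (basis u i) k - seq (basis v i) k)) →
    (λ k → ∑ λ i → t i * seq (x i) k) ~ (λ _ → t u - t v)
  edge-functional t x u v x≋ = ~-resp
    {λ k → ∑ λ i → t i * seq (x i) k} {_} {λ k → ∑ λ i → t i * (δ u i - δ v i)} {λ _ → t u - t v}
    (λ _ → refl) (λ _ → ∑-δ-δ t u v)
    (~-∑ {f = λ i k → t i * seq (x i) k} {g = λ i _ → t i * (δ u i - δ v i)} λ i →
      ~-* {λ _ → t i} {seq (x i)} {λ _ → δ u i - δ v i} (bounded-const (t i))
        (~-resp {seq (x i)} {seq (x i)} {λ k → seq (basis u i) k - seq (basis v i) k} {λ _ → δ u i - δ v i}
          (λ _ → refl) (λ k → cong₂ _-_ (seq-basis u i k) (seq-basis v i k)) (x≋ i)))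

  -- The value of a linear functional at a convex combination is the same combination of its values
  -- t u - t v at edge vectors, each at most M. The bound 0 ≤ M serves the edgeless case, where the
  -- polytope is the origin.
  polytope-functional : ∀ {n} (t : Fin n → ℚ) (y : Vector ℝ n) M → 0ℚ ≤ M → (∀ u v → t u - t v ≤ M) →
    symmetricEdgePolytope (completeGraph n) y → (λ k → ∑ λ i → t i * seq (y i) k) ≲ (λ _ → M)
  polytope-functional {n} t y M 0≤M t≤M (inj₂ (_ , y≋0)) = ≲-trans
    {λ k → ∑ λ i → t i * seq (y i) k} {λ _ → 0ℚ} {λ _ → M}
    (~⇒≲ {λ k → ∑ λ i → t i * seq (y i) k} {λ _ → 0ℚ}
      (~-resp {λ k → ∑ λ i → t i * seq (y i) k} {_} {λ _ → ∑ λ i → t i * 0ℚ} {λ _ → 0ℚ} (λ _ → refl)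
      (λ _ → trans (sum-cong-≗ {n} λ i → *-zeroʳ (t i)) (∑-zero n))
      (~-∑ {f = λ i k → t i * seq (y i) k} {g = λ i _ → t i * 0ℚ} λ i →
        ~-* {λ _ → t i} {seq (y i)} {λ _ → 0ℚ} (bounded-const (t i)) (y≋0 i))))
    (≤⇒≲ 0≤M)
  polytope-functional {n} t y M 0≤M t≤M (inj₁ (_ , m , c , p , 0≤c , ∑c≈1 , edge , y≋)) = ≲-trans
    {λ k → ∑ λ i → t i * Y i k} {λ k → ∑ λ j → C j k * τ j} {λ _ → M}
    (~⇒≲ {λ k → ∑ λ i → t i * Y i k} {λ k → ∑ λ j → C j k * τ j}
      (~-trans {λ k → ∑ λ i → t i * Y i k} {λ k → ∑ λ i → t i * ∑ λ j → C j k * P j i k} {λ k → ∑ λ j → C j k * τ j}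
        (~-∑ {f = λ i k → t i * Y i k} {g = λ i k → t i * ∑ λ j → C j k * P j i k} λ i →
          ~-* {λ _ → t i} {Y i} {λ k → ∑ λ j → C j k * P j i k} (bounded-const (t i))
            (~-resp {Y i} {Y i} {seq (Defs.sum λ j → c j Defs.* p j i)} {λ k → ∑ λ j → C j k * P j i k}
              (λ _ → refl) (seq-sum λ j → c j Defs.* p j i) (y≋ i)))
        (~-resp {λ k → ∑ λ j → C j k * ∑ λ i → t i * P j i k} {λ k → ∑ λ i → t i * ∑ λ j → C j k * P j i k}
                {λ k → ∑ λ j → C j k * τ j} {λ k → ∑ λ j → C j k * τ j}
          (λ k → exchange (λ j → C j k) (λ j i → P j i k)) (λ _ → refl)
          (~-∑ {f = λ j k → C j k * ∑ λ i → t i * P j i k} {g = λ j k → C j k * τ j} λ j →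
            ~-* {C j} {λ k → ∑ λ i → t i * P j i k} {λ _ → τ j} (bounded-cauchy (C j) (cauchy (c j)))
              (let u , v , _ , pj≋ = edge j in edge-functional t (p j) u v pj≋)))))
    (≲-trans {λ k → ∑ λ j → C j k * τ j} {λ k → ∑ λ j → C j k * M} {λ _ → M}
      (≲-∑ {f = λ j k → C j k * τ j} {g = λ j k → C j k * M} λ j →
        -- The weight `C j` is nonnegative only in the limit, so monotonicity cannot be applied
        -- termwise; the constant M - τ j ≥ 0 multiplies the sequence 0 - C j, which is `NonPos`.
        nonPos-resp (λ k → (M - τ j) * (0ℚ - C j k)) (λ k → C j k * τ j - C j k * M)
          (λ k → rearrange M (τ j) (C j k))
          (nonPos-* (M - τ j) (λ k → 0ℚ - C j k) (0≤M-τ j) (0≤c j)))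
      (~⇒≲ {λ k → ∑ λ j → C j k * M} {λ _ → M}
        (~-resp {λ k → M * ∑ λ j → C j k} {λ k → ∑ λ j → C j k * M} {λ _ → M * 1ℚ} {λ _ → M}
          (λ k → trans (*-distribˡ-sum M (λ j → C j k)) (sum-cong-≗ λ j → *-comm M (C j k)))
          (λ _ → *-identityʳ M)
          (~-* {λ _ → M} {λ k → ∑ λ j → C j k} {λ _ → 1ℚ} (bounded-const M)
            (~-resp {seq (Defs.sum c)} {λ k → ∑ λ j → C j k} {λ _ → 1ℚ} {λ _ → 1ℚ}
              (seq-sum c) (λ _ → refl) ∑c≈1)))))
    where
    Y : Fin n → Seq
    Y i = seq (y i)
    C : Fin m → Seq
    C j = seq (c j)
    P : Fin m → Fin n → Seq
    P j i = seq (p j i)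
    τ : Fin m → ℚ
    τ j = let u , v , _ = edge j in t u - t v
    0≤M-τ : ∀ j → 0ℚ ≤ M - τ j
    0≤M-τ j = let u , v , _ = edge j in
      subst (_≤ M - τ j) (+-inverseʳ (τ j)) (+-monoˡ-≤ (- τ j) (t≤M u v))
    rearrange : ∀ M t c → (M - t) * (0ℚ - c) ≡ c * t - c * M
    rearrange = solve-∀ ℚ-ring
    exchange : (C : Fin m → ℚ) (P : Fin m → Fin n → ℚ) →
      (∑ λ j → C j * ∑ λ i → t i * P j i) ≡ (∑ λ i → t i * ∑ λ j → C j * P j i)
    exchange C P = begin
      (∑ λ j → C j * ∑ λ i → t i * P j i)   ≡⟨ sum-cong-≗ (λ j → *-distribˡ-sum (C j) (λ i → t i * P j i)) ⟩
      (∑ λ j → ∑ λ i → C j * (t i * P j i)) ≡⟨ ∑-comm (λ j i → C j * (t i * P j i)) ⟩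
      (∑ λ i → ∑ λ j → C j * (t i * P j i)) ≡⟨ sum-cong-≗ (λ i → sum-cong-≗ λ j → swap (C j) (t i) (P j i)) ⟩
      (∑ λ i → ∑ λ j → t i * (C j * P j i)) ≡⟨ sum-cong-≗ (λ i → *-distribˡ-sum (t i) (λ j → C j * P j i)) ⟨
      (∑ λ i → t i * ∑ λ j → C j * P j i)   ∎
      where
      open ≡-Reasoning
      swap : ∀ a b c → a * (b * c) ≡ b * (a * c)
      swap = solve-∀ ℚ-ring

  -- The functional with coefficients χ (a_i) takes the value `pos a` at a and at most 1 at every
  -- edge vector; it is the inequality behind `pos a ≤ s`.
  χ : ℤ → ℚ
  χ (ℤ.+ _)  = 1ℚ
  χ -[1+ _ ] = 0ℚ

  χ-χ : ∀ i j → χ i - χ j ≤ 1ℚ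
  χ-χ (ℤ.+ _)  (ℤ.+ _)  = nonNegative⁻¹ 1ℚ
  χ-χ (ℤ.+ _)  -[1+ _ ] = ≤-refl
  χ-χ -[1+ _ ] (ℤ.+ _)  = ≤-trans (nonPositive⁻¹ (- 1ℚ)) (nonNegative⁻¹ 1ℚ)
  χ-χ -[1+ _ ] -[1+ _ ] = nonNegative⁻¹ 1ℚ

  ∑-χ : ∀ {n} (a : Vec ℤ n) → ∑ (λ i → χ (lookup a i) * ι (lookup a i)) ≡ ι (ℤ.+ pos a)
  ∑-χ []      = refl
  ∑-χ (i ∷ a) = trans (cong₂ _+_ (χ*ι i) (∑-χ a)) (sym (ι-+ (ℤ.+ posPart i) (ℤ.+ pos a)))
    where
    χ*ι : ∀ i → χ i * ι i ≡ ι (ℤ.+ posPart i)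
    χ*ι i@(ℤ.+ _)  = *-identityˡ (ι i)
    χ*ι i@(-[1+ _ ]) = *-zeroˡ (ι i)

  ∑-ι : ∀ {n} (a : Vec ℤ n) → ∑ (λ i → ι (lookup a i)) ≡ ι (ℤ.+ pos a ℤ.- ℤ.+ neg a)
  ∑-ι []      = refl
  ∑-ι (i ∷ a) = trans (cong (ι i +_) (∑-ι a)) (trans (sym (ι-+ i (ℤ.+ pos a ℤ.- ℤ.+ neg a))) (cong ι (split i)))
    where
    regroup : ∀ p q x y → (p ℤ.- q) ℤ.+ (x ℤ.- y) ≡ (p ℤ.+ x) ℤ.- (q ℤ.+ y)
    regroup = ℤ-Solver.solve-∀
    parts : ∀ i → i ≡ ℤ.+ posPart i ℤ.- ℤ.+ negPart i
    parts (ℤ.+ n)  = sym (ℤ.+-identityʳ (ℤ.+ n))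
    parts -[1+ n ] = refl
    split : ∀ i → i ℤ.+ (ℤ.+ pos a ℤ.- ℤ.+ neg a) ≡ ℤ.+ (posPart i ℕ.+ pos a) ℤ.- ℤ.+ (negPart i ℕ.+ neg a)
    split i = trans (cong (ℤ._+ (ℤ.+ pos a ℤ.- ℤ.+ neg a)) (parts i))
      (regroup (ℤ.+ posPart i) (ℤ.+ negPart i) (ℤ.+ pos a) (ℤ.+ neg a))

  module _ {n} (s : ℕ) (a : Vec ℤ n)
    (lattice : LatticePoint (dilate (fromℕ s) (symmetricEdgePolytope (completeGraph n))) a) where

    -- Both ends are rational constants, so the inequality valid up to every ε becomes exact,
    -- although the point y between them is known only through approximations.
    functional : ∀ (t : Fin n → ℚ) M → 0ℚ ≤ M → (∀ u v → t u - t v ≤ M) →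
      ∑ (λ i → t i * ι (lookup a i)) ≤ ι (ℤ.+ s) * M
    functional t M 0≤M t≤M = let y , Py , a≋ = lattice in ≲-const
      (≲-trans {λ _ → ∑ λ i → t i * ι (lookup a i)} {λ k → ι (ℤ.+ s) * ∑ λ i → t i * seq (y i) k} {λ _ → ι (ℤ.+ s) * M}
        (~⇒≲ {λ _ → ∑ λ i → t i * ι (lookup a i)} {λ k → ι (ℤ.+ s) * ∑ λ i → t i * seq (y i) k}
          (~-resp {λ _ → ∑ λ i → t i * ι (lookup a i)} {_} {λ k → ∑ λ i → t i * (ι (ℤ.+ s) * seq (y i) k)} {λ k → ι (ℤ.+ s) * ∑ λ i → t i * seq (y i) k}
            (λ _ → refl) (λ k → trans (sum-cong-≗ {n} λ i → swap (t i) (ι (ℤ.+ s)) (seq (y i) k))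
                                      (sym (*-distribˡ-sum (ι (ℤ.+ s)) λ i → t i * seq (y i) k)))
            (~-∑ {f = λ i _ → t i * ι (lookup a i)} {g = λ i k → t i * (ι (ℤ.+ s) * seq (y i) k)} λ i →
              ~-* {λ _ → t i} {λ _ → ι (lookup a i)} {λ k → ι (ℤ.+ s) * seq (y i) k} (bounded-const (t i)) (a≋ i))))
        (≲-* {ι (ℤ.+ s)} {λ k → ∑ λ i → t i * seq (y i) k} {λ _ → M} (ι-mono {ℤ.0ℤ} {ℤ.+ s} (ℤ.+≤+ ℕ.z≤n))
          (polytope-functional t y M 0≤M t≤M Py)))
      where
      swap : ∀ a b c → a * (b * c) ≡ b * (a * c)
      swap = solve-∀ ℚ-ring

    private
      total : ℤ
      total = ℤ.+ pos a ℤ.- ℤ.+ neg a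

      -- A constant functional is 0 on every edge vector, so M = 0 is admissible. Taking c = 1 and c
      -- = -1 bounds the sum of the entries from both sides.
      constant : ∀ c → c * ι total ≤ 0ℚ
      constant c = subst₂ _≤_
        (trans (sym (*-distribˡ-sum c λ i → ι (lookup a i))) (cong (c *_) (∑-ι a)))
        (*-zeroʳ (ι (ℤ.+ s)))
        (functional (λ _ → c) 0ℚ ≤-refl λ _ _ → ≤-reflexive (+-inverseʳ c))

      total≤0 : total ℤ.≤ ℤ.0ℤ
      total≤0 = ι-cancel (subst (_≤ 0ℚ) (*-identityˡ (ι total)) (constant 1ℚ))

      total≥0 : ℤ.0ℤ ℤ.≤ total
      total≥0 = ι-cancel (subst₂ _≤_ refl (lemma (ι total)) (neg-antimono-≤ (constant (- 1ℚ))))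
        where
        lemma : ∀ a → - (- 1ℚ * a) ≡ a
        lemma = solve-∀ ℚ-ring

    lattice⇒balanced : Balanced s a
    lattice⇒balanced =
      ℤ.+-injective (ℤ.i-j≡0⇒i≡j (ℤ.+ pos a) (ℤ.+ neg a) (ℤ.≤-antisym total≤0 total≥0)) ,
      ℤ.drop‿+≤+ (ι-cancel (subst₂ _≤_ (∑-χ a) (*-identityʳ (ι (ℤ.+ s)))
        (functional (λ i → χ (lookup a i)) 1ℚ (nonNegative⁻¹ 1ℚ) λ u v → χ-χ (lookup a u) (lookup a v))))

-- Balanced vectors as scaled means of edge vectors

module Cone where

  import Defs
  open Defs using (ℝ; seq; fromℕ; fromℚ; basis; LatticePoint; dilate; ConvexHull; EdgeVector; HasEdge; symmetricEdgePolytope; completeGraph)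
  open Counting using (pos; neg; posPart; negPart; total; Balanced)
  open Sequences
  open Hull using (δ; seq-basis; seq-sum)
  import Algebra.Properties.CommutativeSemigroup as CommutativeSemigroup
  open import Data.Fin.Base using (Fin; zero; suc)
  open import Data.Integer.Base as ℤ using (ℤ; -[1+_])
  import Data.Integer.Properties as ℤ
  open import Data.List.Base as List using (List; []; _∷_; _++_; length; replicate)
  open import Data.List.Properties using (length-++; length-map; length-replicate)
  open import Data.List.Relation.Unary.All as All using (All; []; _∷_)
  import Data.List.Relation.Unary.All.Properties as All
  open import Data.Nat.Base as ℕ using (ℕ; zero; suc)
  import Data.Nat.Properties as ℕ
  open import Data.Product.Base using (∃-syntax; _×_; _,_)
  open import Data.Rational.Base using (ℚ; 0ℚ; 1ℚ; ½; _+_; _*_; _-_; -_; _≤_)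
  open import Data.Rational.Properties
  open import Data.Sum.Base using (inj₁; inj₂)
  open import Data.Vec.Base using (Vec; []; _∷_; lookup)
  open import Data.Vec.Functional using (Vector)
  open import Function.Base using (_∘_)
  open import Relation.Binary.PropositionalEquality
  open import Relation.Nullary using (¬_)
  open import Tactic.RingSolver using (solve-∀)

  ∑ₗ : ∀ {A : Set} → (A → ℚ) → List A → ℚ
  ∑ₗ f []       = 0ℚ
  ∑ₗ f (x ∷ xs) = f x + ∑ₗ f xs

  ∑ₗ-++ : ∀ {A : Set} (f : A → ℚ) xs ys → ∑ₗ f (xs ++ ys) ≡ ∑ₗ f xs + ∑ₗ f ys
  ∑ₗ-++ f []       ys = sym (+-identityˡ (∑ₗ f ys))
  ∑ₗ-++ f (x ∷ xs) ys = trans (cong (f x +_) (∑ₗ-++ f xs ys)) (sym (+-assoc (f x) (∑ₗ f xs) (∑ₗ f ys)))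

  ∑ₗ-map : ∀ {A B : Set} (f : B → ℚ) (g : A → B) xs → ∑ₗ f (List.map g xs) ≡ ∑ₗ (f ∘ g) xs
  ∑ₗ-map f g []       = refl
  ∑ₗ-map f g (x ∷ xs) = cong (f (g x) +_) (∑ₗ-map f g xs)

  ∑ₗ-zero : ∀ {A : Set} (xs : List A) → ∑ₗ (λ _ → 0ℚ) xs ≡ 0ℚ
  ∑ₗ-zero []       = refl
  ∑ₗ-zero (x ∷ xs) = trans (+-identityˡ (∑ₗ (λ _ → 0ℚ) xs)) (∑ₗ-zero xs)

  ∑ₗ-replicate : ∀ {A : Set} (f : A → ℚ) k x → ∑ₗ f (replicate k x) ≡ ι (ℤ.+ k) * f x
  ∑ₗ-replicate f zero    x = sym (*-zeroˡ (f x))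
  ∑ₗ-replicate f (suc k) x = begin
    f x + ∑ₗ f (replicate k x)   ≡⟨ cong (f x +_) (∑ₗ-replicate f k x) ⟩
    f x + ι (ℤ.+ k) * f x        ≡⟨ lemma (f x) (ι (ℤ.+ k)) ⟩
    (1ℚ + ι (ℤ.+ k)) * f x       ≡⟨ cong (_* f x) (ι-+ ℤ.1ℤ (ℤ.+ k)) ⟨
    ι (ℤ.+ suc k) * f x          ∎
    where
    open ≡-Reasoning
    lemma : ∀ x k → x + k * x ≡ (1ℚ + k) * x
    lemma = solve-∀ ℚ-ring

  ∑-lookup : ∀ {A : Set} (f : A → ℚ) xs → ∑ (λ j → f (List.lookup xs j)) ≡ ∑ₗ f xs
  ∑-lookup f []       = refl
  ∑-lookup f (x ∷ xs) = cong (f x +_) (∑-lookup f xs)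

  ∑-constant : ∀ c k → ∑ {k} (λ _ → c) ≡ ι (ℤ.+ k) * c
  ∑-constant c zero    = sym (*-zeroˡ c)
  ∑-constant c (suc k) = begin
    c + ∑ {k} (λ _ → c)          ≡⟨ cong (c +_) (∑-constant c k) ⟩
    c + ι (ℤ.+ k) * c            ≡⟨ lemma c (ι (ℤ.+ k)) ⟩
    (1ℚ + ι (ℤ.+ k)) * c         ≡⟨ cong (_* c) (ι-+ ℤ.1ℤ (ℤ.+ k)) ⟨
    ι (ℤ.+ suc k) * c            ∎
    where
    open ≡-Reasoning
    lemma : ∀ x k → x + k * x ≡ (1ℚ + k) * x
    lemma = solve-∀ ℚ-ring

  -- Index u is listed f (a_u) times. For balanced a the lists from `posPart` and `negPart` have
  -- equal length, and matching them term by term writes a as a sum of `pos a` edge vectors.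
  spread : ∀ {n} → (ℤ → ℕ) → Vec ℤ n → List (Fin n)
  spread f []      = []
  spread f (i ∷ a) = replicate (f i) zero ++ List.map suc (spread f a)

  length-spread : ∀ {n} f (a : Vec ℤ n) → length (spread f a) ≡ total f a
  length-spread f []      = refl
  length-spread f (i ∷ a) = trans (length-++ (replicate (f i) zero))
    (cong₂ ℕ._+_ (length-replicate (f i)) (trans (length-map suc (spread f a)) (length-spread f a)))

  -- No entry has both parts nonzero, so these witnesses show that matched indices differ and
  -- therefore span an edge.
  spread-nonzero : ∀ {n} f (a : Vec ℤ n) → All (λ u → f (lookup a u) ≢ 0) (spread f a)
  spread-nonzero f []      = []
  spread-nonzero {suc n} f (i ∷ a) = All.++⁺ (zeros (f i) λ e → e)
    (All.map⁺ (spread-nonzero f a))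
    where
    -- k stands for f i. Keeping it apart allows a split on k while f i stays visible in the claim.
    zeros : ∀ k → (f i ≡ 0 → k ≡ 0) → All (λ u → f (lookup (i ∷ a) u) ≢ 0) (replicate k zero)
    zeros zero    h = []
    zeros (suc k) h = (λ e → ℕ.1+n≢0 (h e)) ∷ All.replicate⁺ k λ e → ℕ.1+n≢0 (h e)

  ∑ₗ-spread : ∀ {n} f (a : Vec ℤ n) i → ∑ₗ (λ u → δ u i) (spread f a) ≡ ι (ℤ.+ f (lookup a i))
  ∑ₗ-spread f (k ∷ a) i = trans (∑ₗ-++ (λ u → δ u i) (replicate (f k) zero) (List.map suc (spread f a)))
    (trans (cong₂ _+_ (∑ₗ-replicate (λ u → δ u i) (f k) zero) (∑ₗ-map (λ u → δ u i) suc (spread f a))) (go i))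
    where
    go : ∀ i → ι (ℤ.+ f k) * δ zero i + ∑ₗ (λ u → δ (suc u) i) (spread f a) ≡ ι (ℤ.+ f (lookup (k ∷ a) i))
    go zero    = trans (cong₂ _+_ (*-identityʳ (ι (ℤ.+ f k))) (∑ₗ-zero (spread f a))) (+-identityʳ (ι (ℤ.+ f k)))
    go (suc i) = trans (cong₂ _+_ (*-zeroʳ (ι (ℤ.+ f k))) (∑ₗ-spread f a i)) (+-identityˡ (ι (ℤ.+ f (lookup a i))))

  Edge : ℕ → Set
  Edge n = ∃[ u ] ∃[ v ] (_≢_ {A = Fin n} u v)

  vector : ∀ {n} → Edge n → Fin n → ℚ
  vector (u , v , _) i = δ u i - δ v i

  module _ {n} (P N : Fin n → Set) (disjoint : ∀ u → P u → ¬ N u) where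

    -- Every edge is taken twice: the padding below comes in pairs of opposite edges.
    pairs : ∀ {ps ns} → All P ps → All N ns → length ps ≡ length ns → List (Edge n)
    pairs [] [] _ = []
    pairs {u ∷ _} {v ∷ _} (p ∷ ps) (q ∷ qs) e =
      uv ∷ uv ∷ pairs ps qs (ℕ.suc-injective e)
      where
      uv : Edge n
      uv = u , v , λ { refl → disjoint u p q }

    length-pairs : ∀ {ps ns} (p : All P ps) (q : All N ns) e → length (pairs p q e) ≡ length ps ℕ.+ length ps
    length-pairs [] [] e = refl
    length-pairs {_ ∷ us} (_ ∷ p) (_ ∷ q) e = cong suc (trans (cong suc (length-pairs p q (ℕ.suc-injective e)))
      (sym (ℕ.+-suc (length us) (length us))))

    ∑ₗ-pairs : ∀ {ps ns} (p : All P ps) (q : All N ns) e i → ∑ₗ (λ e → vector e i) (pairs p q e) ≡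
      (1ℚ + 1ℚ) * (∑ₗ (λ u → δ u i) ps - ∑ₗ (λ u → δ u i) ns)
    ∑ₗ-pairs [] [] e i = refl
    ∑ₗ-pairs {u ∷ us} {v ∷ vs} (_ ∷ p) (_ ∷ q) e i = begin
      x + (x + ∑ₗ (λ e → vector e i) (pairs p q (ℕ.suc-injective e)))
        ≡⟨ cong (λ y → x + (x + y)) (∑ₗ-pairs p q (ℕ.suc-injective e) i) ⟩
      x + (x + (1ℚ + 1ℚ) * (Us - Vs))
        ≡⟨ lemma (δ u i) (δ v i) Us Vs ⟩
      (1ℚ + 1ℚ) * ((δ u i + Us) - (δ v i + Vs)) ∎
      where
      open ≡-Reasoning
      x  = δ u i - δ v i
      Us = ∑ₗ (λ u → δ u i) us
      Vs = ∑ₗ (λ u → δ u i) vs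
      lemma : ∀ u v a b → (u - v) + ((u - v) + (1ℚ + 1ℚ) * (a - b)) ≡ (1ℚ + 1ℚ) * ((u + a) - (v + b))
      lemma = solve-∀ ℚ-ring

  -- Vectors of sum 0 that fill the list up to the required length. Opposite edges close only an
  -- even gap, and the gap from 2 pos a to 2 s is even.
  padding : ∀ {n} → ℕ → List (Edge (suc (suc n)))
  padding zero    = []
  padding (suc k) = (zero , suc zero , λ ()) ∷ (suc zero , zero , λ ()) ∷ padding k

  length-padding : ∀ {n} k → length (padding {n} k) ≡ k ℕ.+ k
  length-padding zero    = refl
  length-padding (suc k) = cong suc (trans (cong suc (length-padding k)) (sym (ℕ.+-suc k k)))

  ∑ₗ-padding : ∀ {n} k i → ∑ₗ (λ e → vector e i) (padding {n} k) ≡ 0ℚ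
  ∑ₗ-padding zero    i = refl
  ∑ₗ-padding {n} (suc k) i = trans (cong (λ y → vector (zero , suc zero , λ ()) i + (vector (suc zero , zero , λ ()) i + y)) (∑ₗ-padding {n} k i))
    (lemma (δ zero i) (δ (suc zero) i))
    where
    lemma : ∀ a b → (a - b) + ((b - a) + 0ℚ) ≡ 0ℚ
    lemma = solve-∀ ℚ-ring

  ι-parts : ∀ i → ι (ℤ.+ posPart i) - ι (ℤ.+ negPart i) ≡ ι i
  ι-parts (ℤ.+ k)  = +-identityʳ (ι (ℤ.+ k))
  ι-parts -[1+ k ] = begin
    0ℚ - ι (ℤ.+ suc k)                               ≡⟨ lemma (ι (ℤ.+ suc k)) (ι -[1+ k ]) ⟩
    ι -[1+ k ] - (ι (ℤ.+ suc k) + ι -[1+ k ])        ≡⟨ cong (λ x → ι -[1+ k ] - x) (ι-+ (ℤ.+ suc k) -[1+ k ]) ⟨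
    ι -[1+ k ] - ι (ℤ.+ suc k ℤ.+ -[1+ k ])          ≡⟨ cong (λ x → ι -[1+ k ] - ι x) (ℤ.+-inverseʳ (ℤ.+ suc k)) ⟩
    ι -[1+ k ] - 0ℚ                                  ≡⟨ +-identityʳ (ι -[1+ k ]) ⟩
    ι -[1+ k ]                                       ∎
    where
    open ≡-Reasoning
    lemma : ∀ a b → 0ℚ - a ≡ b - (a + b)
    lemma = solve-∀ ℚ-ring

  edges : ∀ {n} s (a : Vec ℤ (suc (suc n))) → Balanced s a →
    ∃[ es ] length es ≡ s ℕ.+ s × (∀ i → ∑ₗ (λ e → vector e i) es ≡ (1ℚ + 1ℚ) * ι (lookup a i))
  edges {n} s a (pos≡neg , pos≤s) =
    proper ++ extra ,
    (begin
      length (proper ++ extra)                                ≡⟨ length-++ proper ⟩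
      length proper ℕ.+ length extra                          ≡⟨ cong₂ ℕ._+_ (length-pairs P N disjoint ps ns same) (length-padding {n} (s ℕ.∸ pos a)) ⟩
      (lp ℕ.+ lp) ℕ.+ ((s ℕ.∸ pos a) ℕ.+ (s ℕ.∸ pos a))       ≡⟨ cong (λ l → (l ℕ.+ l) ℕ.+ ((s ℕ.∸ pos a) ℕ.+ (s ℕ.∸ pos a))) (length-spread posPart a) ⟩
      (pos a ℕ.+ pos a) ℕ.+ ((s ℕ.∸ pos a) ℕ.+ (s ℕ.∸ pos a)) ≡⟨ interchange (pos a) (s ℕ.∸ pos a) ⟩
      (pos a ℕ.+ (s ℕ.∸ pos a)) ℕ.+ (pos a ℕ.+ (s ℕ.∸ pos a)) ≡⟨ cong (λ l → l ℕ.+ l) (ℕ.m+[n∸m]≡n pos≤s) ⟩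
      s ℕ.+ s                                                 ∎) ,
    λ i → begin
      ∑ₗ (λ e → vector e i) (proper ++ extra)
        ≡⟨ ∑ₗ-++ (λ e → vector e i) proper extra ⟩
      ∑ₗ (λ e → vector e i) proper + ∑ₗ (λ e → vector e i) extra
        ≡⟨ cong₂ _+_ (∑ₗ-pairs P N disjoint ps ns same i) (∑ₗ-padding {n} (s ℕ.∸ pos a) i) ⟩
      (1ℚ + 1ℚ) * (∑ₗ (λ u → δ u i) (spread posPart a) - ∑ₗ (λ u → δ u i) (spread negPart a)) + 0ℚ
        ≡⟨ +-identityʳ _ ⟩
      (1ℚ + 1ℚ) * (∑ₗ (λ u → δ u i) (spread posPart a) - ∑ₗ (λ u → δ u i) (spread negPart a))
        ≡⟨ cong ((1ℚ + 1ℚ) *_) (trans (cong₂ _-_ (∑ₗ-spread posPart a i) (∑ₗ-spread negPart a i)) (ι-parts (lookup a i))) ⟩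
      (1ℚ + 1ℚ) * ι (lookup a i) ∎
    where
    open ≡-Reasoning
    P N : Fin (suc (suc n)) → Set
    P u = posPart (lookup a u) ≢ 0
    N u = negPart (lookup a u) ≢ 0
    disjoint : ∀ u → P u → ¬ N u
    disjoint u p q with lookup a u
    ... | ℤ.+ _    = q refl
    ... | -[1+ _ ] = p refl
    ps = spread-nonzero posPart a
    ns = spread-nonzero negPart a
    same : length (spread posPart a) ≡ length (spread negPart a)
    same = trans (length-spread posPart a) (trans pos≡neg (sym (length-spread negPart a)))
    proper = pairs P N disjoint ps ns same
    extra = padding {n} (s ℕ.∸ pos a)
    lp = length (spread posPart a)
    interchange : ∀ p q → (p ℕ.+ p) ℕ.+ (q ℕ.+ q) ≡ (p ℕ.+ q) ℕ.+ (p ℕ.+ q)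
    interchange p q = CommutativeSemigroup.interchange ℕ.+-commutativeSemigroup p p q q

  edgeVector : ∀ {n} → Edge n → Vector ℝ n
  edgeVector (u , v , _) i = basis u i Defs.- basis v i

  edgeVector-isEdge : ∀ {n} (e : Edge n) → EdgeVector (completeGraph n) (edgeVector e)
  edgeVector-isEdge (u , v , u≢v) = u , v , u≢v , λ i →
    ~-reflexive {λ k → seq (basis u i) k - seq (basis v i) k} {λ k → seq (basis u i) k - seq (basis v i) k} λ _ → refl

  seq-edgeVector : ∀ {n} (e : Edge n) i m → seq (edgeVector e i) m ≡ vector e i
  seq-edgeVector (u , v , _) i m = cong₂ _-_ (seq-basis u i m) (seq-basis v i m)

  combination : ∀ {k n} → Vector ℝ k → (Fin k → Vector ℝ n) → Vector ℝ n
  combination c p i = Defs.sum (λ j → c j Defs.* p j i)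

  combination-hull : ∀ {k n} {S : Vector ℝ n → Set} (c : Vector ℝ k) (p : Fin k → Vector ℝ n) →
    (∀ j → (λ _ → 0ℚ) ≲ seq (c j)) → (λ m → ∑ λ j → seq (c j) m) ~ (λ _ → 1ℚ) → (∀ j → S (p j)) →
    ConvexHull S (combination c p)
  combination-hull c p 0≤c ∑c≡1 Sp = _ , c , p , 0≤c ,
    ~-resp {λ m → ∑ λ j → seq (c j) m} {seq (Defs.sum c)} {λ _ → 1ℚ} {λ _ → 1ℚ} (λ m → sym (seq-sum c m)) (λ _ → refl) ∑c≡1 ,
    Sp , λ i → ~-reflexive {seq (combination c p i)} {seq (combination c p i)} λ _ → refl

  seq-combination : ∀ {k n} (c : Vector ℝ k) (p : Fin k → Vector ℝ n) i m →
    seq (combination c p i) m ≡ ∑ λ j → seq (c j) m * seq (p j i) m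
  seq-combination c p i m = seq-sum (λ j → c j Defs.* p j i) m

  module _ {n} (es : List (Edge n)) (c : ℚ) (0≤c : 0ℚ ≤ c) (weights : ι (ℤ.+ length es) * c ≡ 1ℚ) where

    private
      cs : Vector ℝ (length es)
      cs _ = fromℚ c

      ps : Fin (length es) → Vector ℝ n
      ps j = edgeVector (List.lookup es j)

    mean : Vector ℝ n
    mean = combination cs ps

    mean-hull : ConvexHull (EdgeVector (completeGraph n)) mean
    mean-hull = combination-hull {S = EdgeVector (completeGraph n)} cs ps (λ j → ≤⇒≲ 0≤c)
      (~-reflexive {λ _ → ∑ {length es} λ _ → c} {λ _ → 1ℚ} λ _ → trans (∑-constant c (length es)) weights)
      λ j → edgeVector-isEdge (List.lookup es j)

    seq-mean : ∀ i m → seq (mean i) m ≡ c * ∑ₗ (λ e → vector e i) es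
    seq-mean i m = begin
      seq (mean i) m
        ≡⟨ seq-combination cs ps i m ⟩
      ∑ (λ j → c * seq (ps j i) m)
        ≡⟨ sum-cong-≗ (λ j → cong (c *_) (seq-edgeVector (List.lookup es j) i m)) ⟩
      ∑ (λ j → c * vector (List.lookup es j) i)
        ≡⟨ *-distribˡ-sum c (λ j → vector (List.lookup es j) i) ⟨
      c * ∑ (λ j → vector (List.lookup es j) i)
        ≡⟨ cong (c *_) (∑-lookup (λ e → vector e i) es) ⟩
      c * ∑ₗ (λ e → vector e i) es ∎
      where
      open ≡-Reasoning

  -- With s = k + 1 and r = 1/s, the 2s vectors of `edges` sum to 2a. Giving each the weight ½ r
  -- makes a convex combination equal to a / s.
  scaled-point : ∀ {n} k (a : Vec ℤ (suc (suc n))) → Balanced (suc k) a →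
    ∃[ y ] ConvexHull (EdgeVector (completeGraph (suc (suc n)))) y ×
      (∀ i m → ι (ℤ.+ suc k) * seq (y i) m ≡ ι (lookup a i))
  scaled-point k a bal =
    let r , 0≤r , inverse = reciprocal k
        es , length-es , ∑-es = edges (suc k) a bal
        0≤c = subst (_≤ ½ * r) (*-zeroʳ ½) (*-monoˡ-≤-nonNeg ½ 0≤r)
        weights = trans (cong (λ l → ι (ℤ.+ l) * (½ * r)) length-es)
          (trans (cong (_* (½ * r)) (ι-+ (ℤ.+ suc k) (ℤ.+ suc k)))
          (trans (halve (ι (ℤ.+ suc k)) r) inverse))
    in mean es (½ * r) 0≤c weights , mean-hull es (½ * r) 0≤c weights ,
      λ i m → trans (cong (ι (ℤ.+ suc k) *_) (trans (seq-mean es (½ * r) 0≤c weights i m) (cong (½ * r *_) (∑-es i))))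
        (cancel (ι (ℤ.+ suc k)) r (ι (lookup a i)) inverse)
    where
    halve : ∀ x r → (x + x) * (½ * r) ≡ x * r
    halve = solve-∀ ℚ-ring
    regroup : ∀ x r a → x * (½ * r * ((1ℚ + 1ℚ) * a)) ≡ x * r * a
    regroup = solve-∀ ℚ-ring
    cancel : ∀ x r a → x * r ≡ 1ℚ → x * (½ * r * ((1ℚ + 1ℚ) * a)) ≡ a
    cancel x r a e = trans (regroup x r a) (trans (cong (_* a) e) (*-identityˡ a))

  parts-zero : ∀ i → posPart i ≡ 0 → negPart i ≡ 0 → i ≡ ℤ.0ℤ
  parts-zero (ℤ.+ k) refl _ = refl

  balanced-zero : ∀ {n} (a : Vec ℤ n) → pos a ≡ 0 → neg a ≡ 0 → ∀ i → lookup a i ≡ ℤ.0ℤ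
  balanced-zero (k ∷ a) p q zero    = parts-zero k (ℕ.m+n≡0⇒m≡0 (posPart k) p) (ℕ.m+n≡0⇒m≡0 (negPart k) q)
  balanced-zero (k ∷ a) p q (suc i) = balanced-zero a (ℕ.m+n≡0⇒n≡0 (posPart k) p) (ℕ.m+n≡0⇒n≡0 (negPart k) q) i

  balanced-one : ∀ i → posPart i ℕ.+ 0 ≡ negPart i ℕ.+ 0 → i ≡ ℤ.0ℤ
  balanced-one (ℤ.+ zero) _ = refl

  scaled⇒lattice : ∀ {n} s (a : Vec ℤ n) (P : Vector ℝ n → Set) (y : Vector ℝ n) → P y →
    (∀ i m → ι (ℤ.+ s) * seq (y i) m ≡ ι (lookup a i)) → LatticePoint (dilate (fromℕ s) P) a
  scaled⇒lattice s a P y Py scaled = y , Py ,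
    λ i → ~-reflexive {λ _ → ι (lookup a i)} {λ m → ι (ℤ.+ s) * seq (y i) m} λ m → sym (scaled i m)

  edgeless⇒lattice : ∀ {n} s (a : Vec ℤ n) → ¬ HasEdge (completeGraph n) → (∀ i → lookup a i ≡ ℤ.0ℤ) →
    LatticePoint (dilate (fromℕ s) (symmetricEdgePolytope (completeGraph n))) a
  edgeless⇒lattice {n} s a ¬edge a≡0 = scaled⇒lattice s a (symmetricEdgePolytope (completeGraph n)) (λ _ → Defs.0ℝ)
    (inj₂ (¬edge , λ i → ~-reflexive {λ _ → 0ℚ} {λ _ → 0ℚ} λ _ → refl))
    (λ i m → trans (*-zeroʳ (ι (ℤ.+ s))) (sym (cong ι (a≡0 i))))

  balanced⇒lattice : ∀ n s (a : Vec ℤ n) → Balanced s a →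
    LatticePoint (dilate (fromℕ s) (symmetricEdgePolytope (completeGraph n))) a
  balanced⇒lattice zero s a _ = edgeless⇒lattice s a (λ { (() , _) }) λ ()
  balanced⇒lattice (suc zero) s (i ∷ []) (e , _) = edgeless⇒lattice s (i ∷ [])
    (λ { (zero , zero , u≢v) → u≢v refl }) (λ { zero → balanced-one i e })
  -- Dilation by 0 forgets the point, yet some point of the hull must be given. Balanced for 0
  -- implies balanced for 1, so `scaled-point` at s = 1 provides one.
  balanced⇒lattice (suc (suc n)) zero a (e , h) =
    let y , y-hull , _ = scaled-point 0 a (e , ℕ.m≤n⇒m≤1+n h) in
    scaled⇒lattice 0 a (symmetricEdgePolytope (completeGraph (suc (suc n)))) y
      (inj₁ ((zero , suc zero , λ ()) , y-hull))
      λ i m → trans (*-zeroˡ (seq (y i) m)) (sym (cong ι (balanced-zero a (ℕ.n≤0⇒n≡0 h) (trans (sym e) (ℕ.n≤0⇒n≡0 h)) i)))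
  balanced⇒lattice (suc (suc n)) (suc k) a bal =
    let y , y-hull , scaled = scaled-point k a bal in
    scaled⇒lattice (suc k) a (symmetricEdgePolytope (completeGraph (suc (suc n)))) y
      (inj₁ ((zero , suc zero , λ ()) , y-hull)) scaled

-- Polynomials over ℚ(i) along sequences, determined by their values at naturals

module Interpolation where

  open Sequences
  open import Algebra.Bundles using (CommutativeRing)
  open import Data.Integer.Base as ℤ using (ℤ)
  open import Data.List.Base using (List; []; _∷_; length)
  open import Data.List.Relation.Unary.All using (All; []; _∷_)
  open import Data.Maybe.Base using (Maybe; just; nothing)
  open import Data.Nat.Base as ℕ using (ℕ; zero; suc)
  import Data.Nat.Properties as ℕ
  open import Data.Product.Base using (∃-syntax; _×_; _,_; proj₁; proj₂)
  open import Data.Rational.Base using (ℚ; 0ℚ; 1ℚ; _+_; _*_; _-_; -_)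
  open import Data.Rational.Properties
  open import Level using (0ℓ)
  open import Relation.Binary.PropositionalEquality hiding ([_])
  open import Relation.Nullary using (yes)
  open import Tactic.RingSolver using (solve-∀)
  open import Tactic.RingSolver.Core.AlmostCommutativeRing using (AlmostCommutativeRing; fromCommutativeRing)

  -- The field ℚ(i); a complex number is a sequence in it.
  𝔾 : Set
  𝔾 = ℚ × ℚ

  infixl 6 _⊕_
  infixl 7 _⊗_
  infix  8 ⊖_

  _⊕_ _⊗_ : 𝔾 → 𝔾 → 𝔾
  (a , b) ⊕ (c , d) = a + c , b + d
  (a , b) ⊗ (c , d) = a * c - b * d , a * d + b * c

  ⊖_ : 𝔾 → 𝔾
  ⊖ (a , b) = - a , - b

  [_] : ℚ → 𝔾
  [ q ] = q , 0ℚ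

  private
    module Laws where
      ⊗-assoc-re : ∀ a b c d e f → (a * c - b * d) * e - (a * d + b * c) * f ≡ a * (c * e - d * f) - b * (c * f + d * e)
      ⊗-assoc-re = solve-∀ ℚ-ring
      ⊗-assoc-im : ∀ a b c d e f → (a * c - b * d) * f + (a * d + b * c) * e ≡ a * (c * f + d * e) + b * (c * e - d * f)
      ⊗-assoc-im = solve-∀ ℚ-ring
      ⊗-comm-re : ∀ a b c d → a * c - b * d ≡ c * a - d * b
      ⊗-comm-re = solve-∀ ℚ-ring
      ⊗-comm-im : ∀ a b c d → a * d + b * c ≡ c * b + d * a
      ⊗-comm-im = solve-∀ ℚ-ring
      ⊗-identity-re : ∀ a b → 1ℚ * a - 0ℚ * b ≡ a
      ⊗-identity-re = solve-∀ ℚ-ring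
      ⊗-identity-im : ∀ a b → 1ℚ * b + 0ℚ * a ≡ b
      ⊗-identity-im = solve-∀ ℚ-ring
      distrib-re : ∀ a b c d e f → a * (c + e) - b * (d + f) ≡ (a * c - b * d) + (a * e - b * f)
      distrib-re = solve-∀ ℚ-ring
      distrib-im : ∀ a b c d e f → a * (d + f) + b * (c + e) ≡ (a * d + b * c) + (a * f + b * e)
      distrib-im = solve-∀ ℚ-ring

    ⊕-assoc : ∀ x y z → (x ⊕ y) ⊕ z ≡ x ⊕ (y ⊕ z)
    ⊕-assoc (a , b) (c , d) (e , f) = cong₂ _,_ (+-assoc a c e) (+-assoc b d f)

    ⊕-comm : ∀ x y → x ⊕ y ≡ y ⊕ x
    ⊕-comm (a , b) (c , d) = cong₂ _,_ (+-comm a c) (+-comm b d)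

    ⊕-identityˡ : ∀ x → [ 0ℚ ] ⊕ x ≡ x
    ⊕-identityˡ (a , b) = cong₂ _,_ (+-identityˡ a) (+-identityˡ b)

    ⊕-inverseˡ : ∀ x → ⊖ x ⊕ x ≡ [ 0ℚ ]
    ⊕-inverseˡ (a , b) = cong₂ _,_ (+-inverseˡ a) (+-inverseˡ b)

    ⊗-assoc : ∀ x y z → (x ⊗ y) ⊗ z ≡ x ⊗ (y ⊗ z)
    ⊗-assoc (a , b) (c , d) (e , f) = cong₂ _,_ (Laws.⊗-assoc-re a b c d e f) (Laws.⊗-assoc-im a b c d e f)

    ⊗-comm : ∀ x y → x ⊗ y ≡ y ⊗ x
    ⊗-comm (a , b) (c , d) = cong₂ _,_ (Laws.⊗-comm-re a b c d) (Laws.⊗-comm-im a b c d)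

    ⊗-identityˡ : ∀ x → [ 1ℚ ] ⊗ x ≡ x
    ⊗-identityˡ (a , b) = cong₂ _,_ (Laws.⊗-identity-re a b) (Laws.⊗-identity-im a b)

    distribˡ : ∀ x y z → x ⊗ (y ⊕ z) ≡ x ⊗ y ⊕ x ⊗ z
    distribˡ (a , b) (c , d) (e , f) = cong₂ _,_ (Laws.distrib-re a b c d e f) (Laws.distrib-im a b c d e f)

  𝔾-commutativeRing : CommutativeRing 0ℓ 0ℓ
  𝔾-commutativeRing = record
    { Carrier = 𝔾 ; _≈_ = _≡_ ; _+_ = _⊕_ ; _*_ = _⊗_ ; -_ = ⊖_ ; 0# = [ 0ℚ ] ; 1# = [ 1ℚ ]
    ; isCommutativeRing = record
      { isRing = record
        { +-isAbelianGroup = record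
          { isGroup = record
            { isMonoid = record
              { isSemigroup = record
                { isMagma = isMagma _⊕_
                ; assoc = ⊕-assoc }
              ; identity = ⊕-identityˡ , λ x → trans (⊕-comm x [ 0ℚ ]) (⊕-identityˡ x) }
            ; inverse = ⊕-inverseˡ , λ x → trans (⊕-comm x (⊖ x)) (⊕-inverseˡ x)
            ; ⁻¹-cong = cong ⊖_ }
          ; comm = ⊕-comm }
        ; *-cong = cong₂ _⊗_
        ; *-assoc = ⊗-assoc
        ; *-identity = ⊗-identityˡ , λ x → trans (⊗-comm x [ 1ℚ ]) (⊗-identityˡ x)
        ; distrib = distribˡ , λ x y z → trans (⊗-comm (y ⊕ z) x)
            (trans (distribˡ x y z) (cong₂ _⊕_ (⊗-comm x y) (⊗-comm x z))) }
      ; *-comm = ⊗-comm } }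
    where
    open import Relation.Binary.PropositionalEquality.Algebra using (isMagma)

  𝔾-ring : AlmostCommutativeRing 0ℓ 0ℓ
  𝔾-ring = fromCommutativeRing 𝔾-commutativeRing zero?
    where
    zero? : ∀ x → Maybe ([ 0ℚ ] ≡ x)
    zero? (a , b) with 0ℚ ≟ a | 0ℚ ≟ b
    ... | yes p | yes q = just (cong₂ _,_ p q)
    ... | _     | _     = nothing

  𝔾Seq : Set
  𝔾Seq = ℕ → 𝔾

  re im : 𝔾Seq → Seq
  re z n = proj₁ (z n)
  im z n = proj₂ (z n)

  Null𝔾 Bounded𝔾 : 𝔾Seq → Set
  Null𝔾 z    = Null (re z) × Null (im z)
  Bounded𝔾 z = Bounded (re z) × Bounded (im z)

  null𝔾-resp : ∀ (x y : 𝔾Seq) → (∀ n → x n ≡ y n) → Null𝔾 x → Null𝔾 y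
  null𝔾-resp x y e (h , k) = null-resp (re x) (re y) (λ n → cong proj₁ (e n)) h ,
                             null-resp (im x) (im y) (λ n → cong proj₂ (e n)) k

  null𝔾-⊕ : ∀ (x y : 𝔾Seq) → Null𝔾 x → Null𝔾 y → Null𝔾 (λ n → x n ⊕ y n)
  null𝔾-⊕ x y (h , k) (h′ , k′) = null-+ (re x) (re y) h h′ , null-+ (im x) (im y) k k′

  null𝔾-⊗ : ∀ (b x : 𝔾Seq) → Bounded𝔾 b → Null𝔾 x → Null𝔾 (λ n → b n ⊗ x n)
  null𝔾-⊗ b x (B , C) (h , k) =
    null-+ (λ n → re b n * re x n) (λ n → - (im b n * im x n)) (null-* (re b) (re x) B h)
      (null-neg (λ n → im b n * im x n) (null-* (im b) (im x) C k)) ,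
    null-+ (λ n → re b n * im x n) (λ n → im b n * re x n) (null-* (re b) (im x) B k) (null-* (im b) (re x) C h)

  bounded𝔾-const : ∀ q → Bounded𝔾 (λ _ → q)
  bounded𝔾-const (a , b) = bounded-const a , bounded-const b

  bounded𝔾-⊕ : ∀ (x y : 𝔾Seq) → Bounded𝔾 x → Bounded𝔾 y → Bounded𝔾 (λ n → x n ⊕ y n)
  bounded𝔾-⊕ x y (h , k) (h′ , k′) = bounded-+ (re x) (re y) h h′ , bounded-+ (im x) (im y) k k′

  bounded𝔾-⊗ : ∀ (x y : 𝔾Seq) → Bounded𝔾 x → Bounded𝔾 y → Bounded𝔾 (λ n → x n ⊗ y n)
  bounded𝔾-⊗ x y (h , k) (h′ , k′) =
    bounded-+ (λ n → re x n * re y n) (λ n → - (im x n * im y n)) (bounded-* (re x) (re y) h h′)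
      (bounded-neg (λ n → im x n * im y n) (bounded-* (im x) (im y) k k′)) ,
    bounded-+ (λ n → re x n * im y n) (λ n → im x n * re y n) (bounded-* (re x) (im y) h k′) (bounded-* (im x) (re y) k h′)

  ev : List 𝔾Seq → 𝔾Seq → 𝔾Seq
  ev []      z n = [ 0ℚ ]
  ev (a ∷ p) z n = a n ⊕ z n ⊗ ev p z n

  bounded𝔾-ev : ∀ {p} z → All Bounded𝔾 p → Bounded𝔾 z → Bounded𝔾 (ev p z)
  bounded𝔾-ev z []      Z = bounded𝔾-const [ 0ℚ ]
  bounded𝔾-ev {a ∷ p} z (A ∷ P) Z = bounded𝔾-⊕ a (λ n → z n ⊗ ev p z n) A (bounded𝔾-⊗ z (ev p z) Z (bounded𝔾-ev z P Z))

  -- The quotient of a ∷ p by z - c, which does not depend on a.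
  quotient : 𝔾Seq → List 𝔾Seq → List 𝔾Seq
  quotient c []      = []
  quotient c (b ∷ p) = ev (b ∷ p) c ∷ quotient c p

  length-quotient : ∀ c p → length (quotient c p) ≡ length p
  length-quotient c []      = refl
  length-quotient c (b ∷ p) = cong suc (length-quotient c p)

  bounded-quotient : ∀ {c p} → Bounded𝔾 c → All Bounded𝔾 p → All Bounded𝔾 (quotient c p)
  bounded-quotient C []      = []
  bounded-quotient C (B ∷ P) = bounded𝔾-ev _ (B ∷ P) C ∷ bounded-quotient C P

  -- Synthetic division: the intermediate values of Horner's scheme at c are the coefficients of the
  -- quotient, and its final value is the remainder. The identity is exact at each index n.
  division : ∀ c a p z n → ev (a ∷ p) z n ≡ ev (a ∷ p) c n ⊕ (z n ⊕ ⊖ c n) ⊗ ev (quotient c p) z n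
  division c a []      z n = lemma (a n) (z n) (c n)
    where
    lemma : ∀ a z c → a ⊕ z ⊗ [ 0ℚ ] ≡ (a ⊕ c ⊗ [ 0ℚ ]) ⊕ (z ⊕ ⊖ c) ⊗ [ 0ℚ ]
    lemma = solve-∀ 𝔾-ring
  division c a (b ∷ p) z n = trans (cong (λ x → a n ⊕ z n ⊗ x) (division c b p z n))
    (lemma (a n) (z n) (c n) (ev (b ∷ p) c n) (ev (quotient c p) z n))
    where
    lemma : ∀ a z c p q → a ⊕ z ⊗ (p ⊕ (z ⊕ ⊖ c) ⊗ q) ≡ (a ⊕ c ⊗ p) ⊕ (z ⊕ ⊖ c) ⊗ (p ⊕ z ⊗ q)
    lemma = solve-∀ 𝔾-ring

  -- The quotient by z - s vanishes at s + 1, s + 2, …, and has one coefficient less.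
  vanishing : ∀ l p → length p ≡ l → All Bounded𝔾 p → ∀ s →
    (∀ k → Null𝔾 (ev p λ _ → [ ι (ℤ.+ (s ℕ.+ k)) ])) → ∀ z → Bounded𝔾 z → Null𝔾 (ev p z)
  vanishing zero    []      _ _ s h z Z = null-0 , null-0
  vanishing (suc l) (a ∷ p) e (A ∷ P) s h z Z = null𝔾-resp
    (λ n → ev (a ∷ p) c n ⊕ (z n ⊕ ⊖ c n) ⊗ ev q z n) (ev (a ∷ p) z) (λ n → sym (division c a p z n))
    (null𝔾-⊕ (ev (a ∷ p) c) (λ n → (z n ⊕ ⊖ c n) ⊗ ev q z n) null-c
      (null𝔾-⊗ (λ n → z n ⊕ ⊖ c n) (ev q z)
        (bounded𝔾-⊕ z (λ n → ⊖ c n) Z (bounded𝔾-const (⊖ [ ι (ℤ.+ s) ])))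
        (vanishing l q (trans (length-quotient c p) (ℕ.suc-injective e)) (bounded-quotient (bounded𝔾-const [ ι (ℤ.+ s) ]) P)
          (suc s) null-q z Z)))
    where
    c : 𝔾Seq
    c _ = [ ι (ℤ.+ s) ]
    q : List 𝔾Seq
    q = quotient c p
    null-c : Null𝔾 (ev (a ∷ p) c)
    null-c = subst (λ k → Null𝔾 (ev (a ∷ p) λ _ → [ ι (ℤ.+ k) ])) (ℕ.+-identityʳ s) (h 0)
    invert : ∀ q′ s k r → k * r ≡ 1ℚ → [ r ] ⊗ (([ s + k ] ⊕ ⊖ [ s ]) ⊗ q′) ≡ q′
    invert (a , b) s k r kr = cong₂ _,_ (trans (x s k r a b) (unit a)) (trans (y s k r a b) (unit b))
      where
      unit : ∀ a → k * r * a ≡ a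
      unit a = trans (cong (_* a) kr) (*-identityˡ a)
      x : ∀ s k r a b → r * ((s + k - s) * a - (0ℚ - 0ℚ) * b) - 0ℚ * ((s + k - s) * b + (0ℚ - 0ℚ) * a) ≡ k * r * a
      x = solve-∀ ℚ-ring
      y : ∀ s k r a b → r * ((s + k - s) * b + (0ℚ - 0ℚ) * a) + 0ℚ * ((s + k - s) * a - (0ℚ - 0ℚ) * b) ≡ k * r * b
      y = solve-∀ ℚ-ring
    subtract : ∀ u v → u ⊕ [ - 1ℚ ] ⊗ v ≡ u ⊕ ⊖ v
    subtract (a , b) (c , d) = cong₂ _,_ (x a b c d) (y a b c d)
      where
      x : ∀ a b c d → a + (- 1ℚ * c - 0ℚ * d) ≡ a + - c
      x = solve-∀ ℚ-ring
      y : ∀ a b c d → b + (- 1ℚ * d + 0ℚ * c) ≡ b + - d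
      y = solve-∀ ℚ-ring
    isolate : ∀ x y → x ⊕ y ⊕ ⊖ x ≡ y
    isolate = solve-∀ 𝔾-ring
    -- At w = s + 1 + k the quotient is (p(w) - p(s)) / (k + 1). The numerator is a difference of
    -- two null sequences, and the denominator is a positive integer with an exact reciprocal.
    null-q : ∀ k → Null𝔾 (ev q λ _ → [ ι (ℤ.+ (suc s ℕ.+ k)) ])
    null-q k = let r , _ , inverse = reciprocal k
                   w : 𝔾Seq
                   w _ = [ ι (ℤ.+ (suc s ℕ.+ k)) ] in
      null𝔾-resp (λ n → [ r ] ⊗ (ev (a ∷ p) w n ⊕ [ - 1ℚ ] ⊗ ev (a ∷ p) c n)) (ev q w)
        (λ n → trans
          (cong ([ r ] ⊗_) (trans (subtract (ev (a ∷ p) w n) (ev (a ∷ p) c n))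
            (trans (cong (_⊕ ⊖ ev (a ∷ p) c n) (division c a p w n)) (isolate (ev (a ∷ p) c n) ((w n ⊕ ⊖ c n) ⊗ ev q w n)))))
          (trans (cong (λ x → [ r ] ⊗ (([ x ] ⊕ ⊖ [ ι (ℤ.+ s) ]) ⊗ ev q w n))
              (trans (cong (λ m → ι (ℤ.+ m)) (sym (ℕ.+-suc s k))) (ι-+ (ℤ.+ s) (ℤ.+ suc k))))
            (invert (ev q w n) (ι (ℤ.+ s)) (ι (ℤ.+ suc k)) r inverse)))
        (null𝔾-⊗ (λ _ → [ r ]) (λ n → ev (a ∷ p) w n ⊕ [ - 1ℚ ] ⊗ ev (a ∷ p) c n) (bounded𝔾-const [ r ])
          (null𝔾-⊕ (ev (a ∷ p) w) (λ n → [ - 1ℚ ] ⊗ ev (a ∷ p) c n)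
            (subst (λ m → Null𝔾 (ev (a ∷ p) λ _ → [ ι (ℤ.+ m) ])) (ℕ.+-suc s k) (h (suc k)))
            (null𝔾-⊗ (λ _ → [ - 1ℚ ]) (ev (a ∷ p) c) (bounded𝔾-const [ - 1ℚ ]) null-c)))

-- The integral recurrence and the zeros of its solutions

module CriticalLine where

  open Convolution using (bin; count; count-p; count-q; bin-1; module Recurrence)
  open Sequences
  open Interpolation
  open import Data.Integer.Base as ℤ using (ℤ)
  import Data.Integer.Properties as ℤ
  import Data.Integer.Tactic.RingSolver as ℤ-Solver
  open import Data.List.Base using (List; []; _∷_)
  open import Data.List.Relation.Unary.All using (All; []; _∷_)
  open import Data.Nat.Base as ℕ using (ℕ; zero; suc)
  open import Data.Product.Base using (∃-syntax; _×_; _,_; proj₁; proj₂)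
  open import Data.Rational.Base using (ℚ; 0ℚ; 1ℚ; ∣_∣; _+_; _*_; _-_; -_; _≤_; nonNegative)
  open import Data.Rational.Properties
  open import Data.Sum.Base using (inj₁; inj₂)
  open import Relation.Binary.PropositionalEquality hiding ([_])
  open import Tactic.RingSolver using (solve-∀)

  add : List 𝔾Seq → List 𝔾Seq → List 𝔾Seq
  add []      q       = q
  add (a ∷ p) []      = a ∷ p
  add (a ∷ p) (b ∷ q) = (λ n → a n ⊕ b n) ∷ add p q

  scale : 𝔾 → List 𝔾Seq → List 𝔾Seq
  scale c []      = []
  scale c (a ∷ p) = (λ n → c ⊗ a n) ∷ scale c p

  ev-add : ∀ p q z n → ev (add p q) z n ≡ ev p z n ⊕ ev q z n
  ev-add []      q       z n = lemma (ev q z n)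
    where
    lemma : ∀ a → a ≡ [ 0ℚ ] ⊕ a
    lemma = solve-∀ 𝔾-ring
  ev-add (a ∷ p) []      z n = lemma (ev (a ∷ p) z n)
    where
    lemma : ∀ a → a ≡ a ⊕ [ 0ℚ ]
    lemma = solve-∀ 𝔾-ring
  ev-add (a ∷ p) (b ∷ q) z n = trans (cong (λ x → a n ⊕ b n ⊕ z n ⊗ x) (ev-add p q z n))
    (lemma (a n) (b n) (z n) (ev p z n) (ev q z n))
    where
    lemma : ∀ a b z p q → a ⊕ b ⊕ z ⊗ (p ⊕ q) ≡ (a ⊕ z ⊗ p) ⊕ (b ⊕ z ⊗ q)
    lemma = solve-∀ 𝔾-ring

  ev-scale : ∀ c p z n → ev (scale c p) z n ≡ c ⊗ ev p z n
  ev-scale c []      z n = lemma c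
    where
    lemma : ∀ c → [ 0ℚ ] ≡ c ⊗ [ 0ℚ ]
    lemma = solve-∀ 𝔾-ring
  ev-scale c (a ∷ p) z n = trans (cong (λ x → c ⊗ a n ⊕ z n ⊗ x) (ev-scale c p z n))
    (lemma c (a n) (z n) (ev p z n))
    where
    lemma : ∀ c a z p → c ⊗ a ⊕ z ⊗ (c ⊗ p) ≡ c ⊗ (a ⊕ z ⊗ p)
    lemma = solve-∀ 𝔾-ring

  bounded-add : ∀ {p q} → All Bounded𝔾 p → All Bounded𝔾 q → All Bounded𝔾 (add p q)
  bounded-add []      Q       = Q
  bounded-add (A ∷ P) []      = A ∷ P
  bounded-add (A ∷ P) (B ∷ Q) = bounded𝔾-⊕ _ _ A B ∷ bounded-add P Q

  bounded-scale : ∀ c {p} → All Bounded𝔾 p → All Bounded𝔾 (scale c p)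
  bounded-scale c []      = []
  bounded-scale c {a ∷ p} (A ∷ P) = bounded𝔾-⊗ (λ _ → c) a (bounded𝔾-const c) A ∷ bounded-scale c P

  -- The coefficients 2d + 3 and (d+1)⁴ of the recurrence for (d!)² D_d: multiplying the one for D
  -- by ((d+1)!)² turns (d+2)² on the left into ((d+2)!)², and (d+1)² ((d+1)!)² on the right is
  -- (d+1)⁴ (d!)².
  α β : ℕ → ℤ
  α d = ℤ.+ 2 ℤ.* ℤ.+ suc d ℤ.+ ℤ.1ℤ
  β d = (ℤ.+ suc d ℤ.* ℤ.+ suc d) ℤ.* (ℤ.+ suc d ℤ.* ℤ.+ suc d)

  constant : ℚ → 𝔾Seq
  constant q _ = [ q ]

  -- (d !)² times the Ehrhart polynomial of the complete graph on d + 1 vertices.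
  P : ℕ → List 𝔾Seq
  P zero          = constant 1ℚ ∷ []
  P (suc zero)    = constant 1ℚ ∷ constant (1ℚ + 1ℚ) ∷ []
  P (suc (suc d)) = add
    (scale [ ι (α d) ] (add (P (suc d)) (scale [ 1ℚ + 1ℚ ] (constant 0ℚ ∷ P (suc d)))))
    (scale [ ι (β d) ] (P d))

  bounded-P : ∀ d → All Bounded𝔾 (P d)
  bounded-P zero          = bounded𝔾-const [ 1ℚ ] ∷ []
  bounded-P (suc zero)    = bounded𝔾-const [ 1ℚ ] ∷ bounded𝔾-const [ 1ℚ + 1ℚ ] ∷ []
  bounded-P (suc (suc d)) = bounded-add
    (bounded-scale [ ι (α d) ] (bounded-add (bounded-P (suc d))
      (bounded-scale [ 1ℚ + 1ℚ ] {constant 0ℚ ∷ P (suc d)} (bounded𝔾-const [ 0ℚ ] ∷ bounded-P (suc d)))))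
    (bounded-scale [ ι (β d) ] (bounded-P d))

  P-step : ∀ d z n → ev (P (suc (suc d))) z n ≡
    [ ι (α d) ] ⊗ ((([ 1ℚ ] ⊕ [ 1ℚ + 1ℚ ] ⊗ z n)) ⊗ ev (P (suc d)) z n) ⊕ [ ι (β d) ] ⊗ ev (P d) z n
  P-step d z n = trans (ev-add (scale [ ι (α d) ] p₂) (scale [ ι (β d) ] (P d)) z n)
    (cong₂ _⊕_
      (trans (ev-scale [ ι (α d) ] p₂ z n) (cong ([ ι (α d) ] ⊗_)
        (trans (ev-add (P (suc d)) (scale [ 1ℚ + 1ℚ ] p₁) z n)
        (trans (cong (ev (P (suc d)) z n ⊕_) (ev-scale [ 1ℚ + 1ℚ ] p₁ z n))
               (lemma [ 1ℚ + 1ℚ ] (z n) (ev (P (suc d)) z n))))))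
      (ev-scale [ ι (β d) ] (P d) z n))
    where
    p₁ = constant 0ℚ ∷ P (suc d)
    p₂ = add (P (suc d)) (scale [ 1ℚ + 1ℚ ] p₁)
    lemma : ∀ c z p → p ⊕ c ⊗ ([ 0ℚ ] ⊕ z ⊗ p) ≡ ([ 1ℚ ] ⊕ c ⊗ z) ⊗ p
    lemma = solve-∀ 𝔾-ring

  factorial² : ℕ → ℤ
  factorial² zero    = ℤ.1ℤ
  factorial² (suc d) = ℤ.+ suc d ℤ.* ℤ.+ suc d ℤ.* factorial² d

  [ι]-+ : ∀ i j → [ ι (i ℤ.+ j) ] ≡ [ ι i ] ⊕ [ ι j ]
  [ι]-+ i j = cong (_, 0ℚ) (ι-+ i j)

  [ι]-* : ∀ i j → [ ι (i ℤ.* j) ] ≡ [ ι i ] ⊗ [ ι j ]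
  [ι]-* i j = cong₂ _,_ (trans (ι-* i j) (x (ι i) (ι j))) (y (ι i) (ι j))
    where
    x : ∀ a b → a * b ≡ a * b - 0ℚ * 0ℚ
    x = solve-∀ ℚ-ring
    y : ∀ a b → 0ℚ ≡ a * 0ℚ + 0ℚ * b
    y = solve-∀ ℚ-ring

  scaled-recurrence : ∀ s d → let D = λ d → bin d (count s s) in
    factorial² (suc (suc d)) ℤ.* D (suc (suc d)) ≡
    α d ℤ.* ((ℤ.1ℤ ℤ.+ ℤ.+ 2 ℤ.* ℤ.+ s) ℤ.* (factorial² (suc d) ℤ.* D (suc d))) ℤ.+ β d ℤ.* (factorial² d ℤ.* D d)
  scaled-recurrence s d = lemma (ℤ.+ suc (suc d)) (ℤ.+ suc d) (ℤ.+ s) (factorial² d) (D (suc (suc d))) (D (suc d)) (D d)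
    (Recurrence.recurrence s (count s s) (count-p s) (count-q s) d)
    where
    D : ℕ → ℤ
    D d = bin d (count s s)
    lemma : ∀ n m s f x y z →
      n ℤ.* n ℤ.* x ≡ (ℤ.+ 2 ℤ.* m ℤ.+ ℤ.1ℤ) ℤ.* (ℤ.+ 2 ℤ.* s ℤ.+ ℤ.1ℤ) ℤ.* y ℤ.+ m ℤ.* m ℤ.* z →
      n ℤ.* n ℤ.* (m ℤ.* m ℤ.* f) ℤ.* x ≡
      (ℤ.+ 2 ℤ.* m ℤ.+ ℤ.1ℤ) ℤ.* ((ℤ.1ℤ ℤ.+ ℤ.+ 2 ℤ.* s) ℤ.* (m ℤ.* m ℤ.* f ℤ.* y)) ℤ.+ (m ℤ.* m) ℤ.* (m ℤ.* m) ℤ.* (f ℤ.* z)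
    lemma n m s f x y z e = trans (l n m f x) (trans (cong (m ℤ.* m ℤ.* f ℤ.*_) e) (r m s f y z))
      where
      l : ∀ n m f x → n ℤ.* n ℤ.* (m ℤ.* m ℤ.* f) ℤ.* x ≡ m ℤ.* m ℤ.* f ℤ.* (n ℤ.* n ℤ.* x)
      l = ℤ-Solver.solve-∀
      r : ∀ m s f y z → m ℤ.* m ℤ.* f ℤ.* ((ℤ.+ 2 ℤ.* m ℤ.+ ℤ.1ℤ) ℤ.* (ℤ.+ 2 ℤ.* s ℤ.+ ℤ.1ℤ) ℤ.* y ℤ.+ m ℤ.* m ℤ.* z) ≡
        (ℤ.+ 2 ℤ.* m ℤ.+ ℤ.1ℤ) ℤ.* ((ℤ.1ℤ ℤ.+ ℤ.+ 2 ℤ.* s) ℤ.* (m ℤ.* m ℤ.* f ℤ.* y)) ℤ.+ (m ℤ.* m) ℤ.* (m ℤ.* m) ℤ.* (f ℤ.* z)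
      r = ℤ-Solver.solve-∀

  P-integer : ∀ s d n → ev (P d) (constant (ι (ℤ.+ s))) n ≡ [ ι (factorial² d ℤ.* bin d (count s s)) ]
  P-integer s zero n = trans (lemma [ 1ℚ ] [ ι (ℤ.+ s) ]) refl
    where
    lemma : ∀ a z → a ⊕ z ⊗ [ 0ℚ ] ≡ a
    lemma = solve-∀ 𝔾-ring
  P-integer s (suc zero) n = trans (lemma [ 1ℚ + 1ℚ ] [ ι (ℤ.+ s) ]) (sym (begin
    [ ι (ℤ.1ℤ ℤ.* bin 1 (count s s)) ]           ≡⟨ cong (λ x → [ ι x ]) (trans (ℤ.*-identityˡ _) (bin-1 s)) ⟩
    [ ι (ℤ.+ 2 ℤ.* ℤ.+ s ℤ.+ ℤ.1ℤ) ]             ≡⟨ [ι]-+ (ℤ.+ 2 ℤ.* ℤ.+ s) ℤ.1ℤ ⟩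
    [ ι (ℤ.+ 2 ℤ.* ℤ.+ s) ] ⊕ [ 1ℚ ]             ≡⟨ cong (_⊕ [ 1ℚ ]) ([ι]-* (ℤ.+ 2) (ℤ.+ s)) ⟩
    [ 1ℚ + 1ℚ ] ⊗ [ ι (ℤ.+ s) ] ⊕ [ 1ℚ ]         ∎))
    where
    open ≡-Reasoning
    lemma : ∀ c z → [ 1ℚ ] ⊕ z ⊗ (c ⊕ z ⊗ [ 0ℚ ]) ≡ c ⊗ z ⊕ [ 1ℚ ]
    lemma = solve-∀ 𝔾-ring
  P-integer s (suc (suc d)) n = begin
    ev (P (suc (suc d))) (constant (ι (ℤ.+ s))) n
      ≡⟨ P-step d (constant (ι (ℤ.+ s))) n ⟩
    [ ι (α d) ] ⊗ (([ 1ℚ ] ⊕ [ 1ℚ + 1ℚ ] ⊗ [ ι (ℤ.+ s) ]) ⊗ ev (P (suc d)) (constant (ι (ℤ.+ s))) n) ⊕ [ ι (β d) ] ⊗ ev (P d) (constant (ι (ℤ.+ s))) n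
      ≡⟨ cong₂ (λ x y → [ ι (α d) ] ⊗ (([ 1ℚ ] ⊕ [ 1ℚ + 1ℚ ] ⊗ [ ι (ℤ.+ s) ]) ⊗ x) ⊕ [ ι (β d) ] ⊗ y) (P-integer s (suc d) n) (P-integer s d n) ⟩
    [ ι (α d) ] ⊗ (([ 1ℚ ] ⊕ [ 1ℚ + 1ℚ ] ⊗ [ ι (ℤ.+ s) ]) ⊗ [ ι y ]) ⊕ [ ι (β d) ] ⊗ [ ι z ]
      ≡⟨ cong (λ x → [ ι (α d) ] ⊗ (([ 1ℚ ] ⊕ x) ⊗ [ ι y ]) ⊕ [ ι (β d) ] ⊗ [ ι z ]) ([ι]-* (ℤ.+ 2) (ℤ.+ s)) ⟨
    [ ι (α d) ] ⊗ (([ 1ℚ ] ⊕ [ ι (ℤ.+ 2 ℤ.* ℤ.+ s) ]) ⊗ [ ι y ]) ⊕ [ ι (β d) ] ⊗ [ ι z ]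
      ≡⟨ cong (λ x → [ ι (α d) ] ⊗ (x ⊗ [ ι y ]) ⊕ [ ι (β d) ] ⊗ [ ι z ]) ([ι]-+ ℤ.1ℤ (ℤ.+ 2 ℤ.* ℤ.+ s)) ⟨
    [ ι (α d) ] ⊗ ([ ι w ] ⊗ [ ι y ]) ⊕ [ ι (β d) ] ⊗ [ ι z ]
      ≡⟨ cong (λ x → [ ι (α d) ] ⊗ x ⊕ [ ι (β d) ] ⊗ [ ι z ]) ([ι]-* w y) ⟨
    [ ι (α d) ] ⊗ [ ι (w ℤ.* y) ] ⊕ [ ι (β d) ] ⊗ [ ι z ]
      ≡⟨ cong₂ _⊕_ ([ι]-* (α d) (w ℤ.* y)) ([ι]-* (β d) z) ⟨
    [ ι (α d ℤ.* (w ℤ.* y)) ] ⊕ [ ι (β d ℤ.* z) ]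
      ≡⟨ [ι]-+ (α d ℤ.* (w ℤ.* y)) (β d ℤ.* z) ⟨
    [ ι (α d ℤ.* (w ℤ.* y) ℤ.+ β d ℤ.* z) ]
      ≡⟨ cong (λ x → [ ι x ]) (scaled-recurrence s d) ⟨
    [ ι (factorial² (suc (suc d)) ℤ.* bin (suc (suc d)) (count s s)) ] ∎
    where
    open ≡-Reasoning
    w = ℤ.1ℤ ℤ.+ ℤ.+ 2 ℤ.* ℤ.+ s
    y = factorial² (suc d) ℤ.* bin (suc d) (count s s)
    z = factorial² d ℤ.* bin d (count s s)

  -- Re (x ȳ), the Euclidean inner product on the complex plane.
  dot : 𝔾 → 𝔾 → ℚ
  dot (a , b) (c , d) = a * c + b * d

  -- Pairing the recurrence with P (d + 1) turns it into
  -- Re (P (d + 2) P̄ (d + 1)) = α Re (2z + 1) ∣P (d + 1)∣² + β Re (P (d + 1) P̄ d).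
  positivity : ∀ z n d → ∃[ S ] 1ℚ ≤ S × dot (ev (P (suc d)) z n) (ev (P d) z n) ≡ (1ℚ + (1ℚ + 1ℚ) * re z n) * S
  positivity z n zero = 1ℚ , ≤-refl , lemma (1ℚ + 1ℚ) (re z n) (im z n)
    where
    lemma : ∀ c x y → dot ([ 1ℚ ] ⊕ (x , y) ⊗ ([ c ] ⊕ (x , y) ⊗ [ 0ℚ ])) ([ 1ℚ ] ⊕ (x , y) ⊗ [ 0ℚ ]) ≡ (1ℚ + c * x) * 1ℚ
    lemma c x y = l c x y
      where
      l : ∀ c x y →
        (1ℚ + (x * (c + (x * 0ℚ - y * 0ℚ)) - y * (0ℚ + (x * 0ℚ + y * 0ℚ)))) * (1ℚ + (x * 0ℚ - y * 0ℚ))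
        + (0ℚ + (x * (0ℚ + (x * 0ℚ + y * 0ℚ)) + y * (c + (x * 0ℚ - y * 0ℚ)))) * (0ℚ + (x * 0ℚ + y * 0ℚ))
        ≡ (1ℚ + c * x) * 1ℚ
      l = solve-∀ ℚ-ring
  positivity z n (suc d) with positivity z n d
  ... | S , 1≤S , e = A * (p * p + q * q) + B * S , bound , (begin
    dot (ev (P (suc (suc d))) z n) (ev (P (suc d)) z n)
      ≡⟨ cong (λ x → dot x (ev (P (suc d)) z n)) (P-step d z n) ⟩
    dot ([ A ] ⊗ (([ 1ℚ ] ⊕ [ 1ℚ + 1ℚ ] ⊗ z n) ⊗ ev (P (suc d)) z n) ⊕ [ B ] ⊗ ev (P d) z n) (ev (P (suc d)) z n)
      ≡⟨ l A B (1ℚ + 1ℚ) (re z n) (im z n) p q (re (ev (P d) z) n) (im (ev (P d) z) n) ⟩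
    A * (w * (p * p + q * q)) + B * dot (ev (P (suc d)) z n) (ev (P d) z n)
      ≡⟨ cong (λ x → A * (w * (p * p + q * q)) + B * x) e ⟩
    A * (w * (p * p + q * q)) + B * (w * S)
      ≡⟨ r A B w (p * p + q * q) S ⟩
    w * (A * (p * p + q * q) + B * S) ∎)
    where
    open ≡-Reasoning
    A = ι (α d)
    B = ι (β d)
    p = re (ev (P (suc d)) z) n
    q = im (ev (P (suc d)) z) n
    w = 1ℚ + (1ℚ + 1ℚ) * re z n
    l : ∀ A B c x y p q p′ q′ →
      (A * ((1ℚ + (c * x - 0ℚ * y)) * p - (0ℚ + (c * y + 0ℚ * x)) * q) - 0ℚ * ((1ℚ + (c * x - 0ℚ * y)) * q + (0ℚ + (c * y + 0ℚ * x)) * p)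
        + (B * p′ - 0ℚ * q′)) * p
      + (A * ((1ℚ + (c * x - 0ℚ * y)) * q + (0ℚ + (c * y + 0ℚ * x)) * p) + 0ℚ * ((1ℚ + (c * x - 0ℚ * y)) * p - (0ℚ + (c * y + 0ℚ * x)) * q)
        + (B * q′ + 0ℚ * p′)) * q
      ≡ A * ((1ℚ + c * x) * (p * p + q * q)) + B * (p * p′ + q * q′)
    l = solve-∀ ℚ-ring
    r : ∀ A B w m S → A * (w * m) + B * (w * S) ≡ w * (A * m + B * S)
    r = solve-∀ ℚ-ring
    square : ∀ x → 0ℚ ≤ x * x
    square x = subst (0ℚ ≤_) (trans (∣p*q∣≡∣p∣*∣q∣ x x) (abs x)) (0≤∣p∣ (x * x))
      where
      abs : ∀ x → ∣ x ∣ * ∣ x ∣ ≡ x * x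
      abs x with ∣p∣≡p∨∣p∣≡-p x
      ... | inj₁ h = cong₂ _*_ h h
      ... | inj₂ h = trans (cong₂ _*_ h h) (neg x)
        where
        neg : ∀ x → - x * - x ≡ x * x
        neg = solve-∀ ℚ-ring
    -- The square term is nonnegative, and B = (d+1)⁴ ≥ 1 passes the bound on. The plus sign before
    -- the last term of the recurrence is essential here. The scaling by (d!)² keeps the bound at 1;
    -- for D itself the factor would be (d+1)²/(d+2)².
    bound : 1ℚ ≤ A * (p * p + q * q) + B * S
    bound = ≤-trans (≤-trans 1≤S (≤-trans (≤-reflexive (sym (*-identityˡ S)))
        (*-monoʳ-≤-nonNeg S {{nonNegative (≤-trans (nonNegative⁻¹ 1ℚ) 1≤S)}} (ι-mono {ℤ.1ℤ} {β d} (ℤ.+≤+ (ℕ.s≤s ℕ.z≤n))))))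
      (≤-trans (≤-reflexive (sym (+-identityˡ (B * S))))
        (+-monoˡ-≤ (B * S) (subst (_≤ A * (p * p + q * q)) (*-zeroʳ A)
          (*-monoˡ-≤-nonNeg A {{nonNegative (ι-mono {ℤ.0ℤ} {α d} (ℤ.+≤+ ℕ.z≤n))}}
            (+-mono-≤ (square p) (square q))))))

  -- At each index |w| ≤ |w S| = |Re (P_{d+1} P̄_d)| with w = Re (2z + 1). The right side tends to
  -- 0, because `P d` stays bounded along the approximants of z and `P (suc d)` is null there.
  critical-line : ∀ d z → Bounded𝔾 z → Null𝔾 (ev (P (suc d)) z) → Null (λ n → 1ℚ + (1ℚ + 1ℚ) * re z n)
  critical-line d z Z (h , k) = null-≤ (λ n → 1ℚ + (1ℚ + 1ℚ) * re z n)
    (λ n → re (ev (P d) z) n * re (ev (P (suc d)) z) n + im (ev (P d) z) n * im (ev (P (suc d)) z) n)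
    (λ n → let S , 1≤S , e = positivity z n d in
      subst (∣ 1ℚ + (1ℚ + 1ℚ) * re z n ∣ ≤_) (cong ∣_∣ (trans (sym e) (cong₂ _+_ (*-comm _ (re (ev (P d) z) n)) (*-comm _ (im (ev (P d) z) n)))))
        (grow (1ℚ + (1ℚ + 1ℚ) * re z n) S 1≤S))
    (null-+ (λ n → re (ev (P d) z) n * re (ev (P (suc d)) z) n) (λ n → im (ev (P d) z) n * im (ev (P (suc d)) z) n)
      (null-* (re (ev (P d) z)) (re (ev (P (suc d)) z)) (proj₁ bounded-d) h)
      (null-* (im (ev (P d) z)) (im (ev (P (suc d)) z)) (proj₂ bounded-d) k))
    where
    bounded-d : Bounded𝔾 (ev (P d) z)
    bounded-d = bounded𝔾-ev z (bounded-P d) Z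
    grow : ∀ w S → 1ℚ ≤ S → ∣ w ∣ ≤ ∣ w * S ∣
    grow w S 1≤S = begin
      ∣ w ∣           ≡⟨ *-identityʳ ∣ w ∣ ⟨
      ∣ w ∣ * 1ℚ      ≤⟨ *-monoˡ-≤-nonNeg ∣ w ∣ {{∣-∣-nonNeg w}} (≤-trans 1≤S (p≤∣p∣ S)) ⟩
      ∣ w ∣ * ∣ S ∣   ≡⟨ ∣p*q∣≡∣p∣*∣q∣ w S ⟨
      ∣ w * S ∣       ∎
      where open ≤-Reasoning


-- From the explicit polynomials to an arbitrary Ehrhart polynomial

open Convolution using (bin; count)
open Counting using (Counted; Balanced; box; balanced; card-resp; card-unique)
open Sequences
open Hull using (lattice⇒balanced)
open Cone using (balanced⇒lattice)
open Interpolation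
open CriticalLine
open import Defs
open import Data.Empty using (⊥; ⊥-elim)
open import Data.Integer.Base as ℤ using (ℤ)
open import Data.List.Base using (List; []; _∷_; length; map)
open import Data.List.Relation.Unary.All using (All; []; _∷_)
open import Data.Nat.Base using (ℕ; zero; suc; pred; z≤n)
open import Data.Product.Base using (_,_; proj₁; proj₂)
open import Data.Rational.Base as ℚ using (ℚ; 0ℚ; 1ℚ; ½)
import Data.Rational.Properties as ℚ
open import Data.Vec.Base using ([])
open import Function.Bundles using (mk⇔)
open import Relation.Binary.PropositionalEquality using (_≡_; refl; sym; trans; cong; cong₂; subst)
open import Tactic.RingSolver using (solve-∀)

approximants : ℂ → 𝔾Seq
approximants z n = seq (Re z) n , seq (Im z) n

bounded-approximants : ∀ z → Bounded𝔾 (approximants z)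
bounded-approximants z = bounded-cauchy (seq (Re z)) (cauchy (Re z)) , bounded-cauchy (seq (Im z)) (cauchy (Im z))

coefficients : Polynomial → List 𝔾Seq
coefficients = map approximants

bounded-coefficients : ∀ H → All Bounded𝔾 (coefficients H)
bounded-coefficients []      = []
bounded-coefficients (a ∷ H) = bounded-approximants a ∷ bounded-coefficients H

ev-coefficients : ∀ H z n → approximants (eval H z) n ≡ ev (coefficients H) (approximants z) n
ev-coefficients []      z n = refl
ev-coefficients (a ∷ H) z n = cong (λ x → approximants a n ⊕ approximants z n ⊗ x) (ev-coefficients H z n)

-- `pred` sends both n = 0 and n = 1 to d = 0. This is right, since either graph is edgeless and its
-- polytope has one lattice point in every dilate.
balanced-count : ∀ n s → Counted (Balanced {n} s) (bin (pred n) (count s s))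
balanced-count zero    s = let k , card , e = box 0 s s in
  k , card-resp (λ { [] → mk⇔ (λ _ → refl , z≤n) (λ _ → z≤n , z≤n) }) card , e
balanced-count (suc d) s = balanced d s

module _ (n : ℕ) (H : Polynomial) (ehrhart : IsEhrhartPolynomial (completeGraph n) H) where

  private
    d : ℕ
    d = pred n

    h : List 𝔾Seq
    h = coefficients H

    f : ℤ
    f = factorial² d

    lattice-count : ∀ s → ℤ.+ proj₁ (ehrhart s) ≡ bin d (count s s)
    lattice-count s = let k , card , e = balanced-count n s in
      trans (cong ℤ.+_ (card-unique (proj₁ (proj₂ (ehrhart s)))
        (card-resp (λ a → mk⇔ (balanced⇒lattice n s a) (lattice⇒balanced s a)) card))) e

    value : ∀ s → Null𝔾 (λ m → ev h (constant (ι (ℤ.+ s))) m ⊕ ⊖ [ ι (bin d (count s s)) ])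
    value s = subst (λ k → Null𝔾 (λ m → ev h (constant (ι (ℤ.+ s))) m ⊕ ⊖ [ ι k ])) (lattice-count s)
      (null𝔾-resp (λ m → approximants (eval H (fromℝ (fromℕ s))) m ⊕ ⊖ [ ι (ℤ.+ proj₁ (ehrhart s)) ])
        (λ m → ev h (constant (ι (ℤ.+ s))) m ⊕ ⊖ [ ι (ℤ.+ proj₁ (ehrhart s)) ])
        (λ m → cong (_⊕ ⊖ [ ι (ℤ.+ proj₁ (ehrhart s)) ]) (ev-coefficients H (fromℝ (fromℕ s)) m))
        (proj₁ (proj₂ (proj₂ (ehrhart s))) , proj₂ (proj₂ (proj₂ (ehrhart s)))))

    -- Null at every natural number by the lattice point count, hence at every bounded argument by
    -- `vanishing`. At a root of `H` this makes `P d`, which is (d!)² H minus `difference`, null as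
    -- well.
    difference : List 𝔾Seq
    difference = add (scale [ ι f ] h) (scale (⊖ [ 1ℚ ]) (P d))

    ev-difference : ∀ z m → ev difference z m ≡ [ ι f ] ⊗ ev h z m ⊕ ⊖ [ 1ℚ ] ⊗ ev (P d) z m
    ev-difference z m = trans (ev-add (scale [ ι f ] h) (scale (⊖ [ 1ℚ ]) (P d)) z m)
      (cong₂ _⊕_ (ev-scale [ ι f ] h z m) (ev-scale (⊖ [ 1ℚ ]) (P d) z m))

    difference-integer : ∀ s → Null𝔾 (ev difference (constant (ι (ℤ.+ s))))
    difference-integer s = null𝔾-resp
      (λ m → [ ι f ] ⊗ (ev h (constant (ι (ℤ.+ s))) m ⊕ ⊖ [ ι (bin d (count s s)) ]))
      (ev difference (constant (ι (ℤ.+ s))))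
      (λ m → sym (trans (ev-difference (constant (ι (ℤ.+ s))) m)
        (trans (cong (λ x → [ ι f ] ⊗ ev h (constant (ι (ℤ.+ s))) m ⊕ ⊖ [ 1ℚ ] ⊗ x)
                 (trans (P-integer s d m) ([ι]-* f (bin d (count s s)))))
               (lemma [ ι f ] (ev h (constant (ι (ℤ.+ s))) m) [ ι (bin d (count s s)) ]))))
      (null𝔾-⊗ (constant (ι f)) (λ m → ev h (constant (ι (ℤ.+ s))) m ⊕ ⊖ [ ι (bin d (count s s)) ])
        (bounded𝔾-const [ ι f ]) (value s))
      where
      lemma : ∀ f x y → f ⊗ x ⊕ ⊖ [ 1ℚ ] ⊗ (f ⊗ y) ≡ f ⊗ (x ⊕ ⊖ y)
      lemma = solve-∀ 𝔾-ring

  root-of-P : ∀ z → IsRoot H z → Null𝔾 (ev (P d) (approximants z))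
  root-of-P z (null-re , null-im) = null𝔾-resp
    (λ m → [ ι f ] ⊗ ev h w m ⊕ ⊖ [ 1ℚ ] ⊗ ev difference w m) (ev (P d) w)
    (λ m → trans (cong (λ x → [ ι f ] ⊗ ev h w m ⊕ ⊖ [ 1ℚ ] ⊗ x) (ev-difference w m))
                 (lemma ([ ι f ] ⊗ ev h w m) (ev (P d) w m)))
    (null𝔾-⊕ (λ m → [ ι f ] ⊗ ev h w m) (λ m → ⊖ [ 1ℚ ] ⊗ ev difference w m)
      (null𝔾-⊗ (constant (ι f)) (ev h w) (bounded𝔾-const [ ι f ])
        (null𝔾-resp (λ m → approximants (eval H z) m ⊕ ⊖ [ 0ℚ ]) (ev h w)
          (λ m → trans (minus-zero (approximants (eval H z) m)) (ev-coefficients H z m)) (null-re , null-im)))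
      (null𝔾-⊗ (λ _ → ⊖ [ 1ℚ ]) (ev difference w) (bounded𝔾-const (⊖ [ 1ℚ ]))
        -- The number of coefficients is a sufficient bound on the degree, whatever leading
        -- coefficients of `H` vanish.
        (vanishing (length difference) difference refl
          (bounded-add (bounded-scale [ ι f ] (bounded-coefficients H)) (bounded-scale (⊖ [ 1ℚ ]) (bounded-P d)))
          0 difference-integer w (bounded-approximants z))))
    where
    w : 𝔾Seq
    w = approximants z
    lemma : ∀ x p → x ⊕ ⊖ [ 1ℚ ] ⊗ (x ⊕ ⊖ [ 1ℚ ] ⊗ p) ≡ p
    lemma = solve-∀ 𝔾-ring
    minus-zero : ∀ x → x ⊕ ⊖ [ 0ℚ ] ≡ x
    minus-zero = solve-∀ 𝔾-ring

P-zero-nonvanishing : ∀ z → Null𝔾 (ev (P 0) z) → ⊥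
P-zero-nonvanishing z null = ℚ.<-irrefl refl (ℚ.<-≤-trans (ℚ.positive⁻¹ 1ℚ) (nonPos-const 1ℚ (null⇒nonPos (λ _ → 1ℚ)
  (proj₁ (null𝔾-resp (ev (P 0) z) (constant 1ℚ) (λ n → lemma [ 1ℚ ] (z n)) null)))))
  where
  lemma : ∀ a z → a ⊕ z ⊗ [ 0ℚ ] ≡ a
  lemma = solve-∀ 𝔾-ring

null⇒R : ∀ z → Null (λ n → 1ℚ ℚ.+ (1ℚ ℚ.+ 1ℚ) ℚ.* seq (Re z) n) → R z
null⇒R z null = null-resp (λ n → ½ ℚ.* (1ℚ ℚ.+ (1ℚ ℚ.+ 1ℚ) ℚ.* seq (Re z) n)) (λ n → seq (Re z) n ℚ.- ℚ.- ½)
  (λ n → lemma (seq (Re z) n))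
  (null-* (λ _ → ½) (λ n → 1ℚ ℚ.+ (1ℚ ℚ.+ 1ℚ) ℚ.* seq (Re z) n) (bounded-const ½) null)
  where
  lemma : ∀ x → ½ ℚ.* (1ℚ ℚ.+ (1ℚ ℚ.+ 1ℚ) ℚ.* x) ≡ x ℚ.- ℚ.- ½
  lemma = solve-∀ ℚ-ring

on-line : ∀ d z → Null𝔾 (ev (P d) (approximants z)) → R z
-- On at most one vertex the polynomial is the constant 1 and has no roots.
on-line zero    z null = ⊥-elim (P-zero-nonvanishing (approximants z) null)
on-line (suc d) z null = null⇒R z (critical-line d (approximants z) (bounded-approximants z) null)

corollary3p8 : ∀ (n : ℕ) (H : Polynomial) → IsEhrhartPolynomial (completeGraph n) H → ∀ (z : ℂ) → IsRoot H z → R z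
corollary3p8 n H ehrhart z root = on-line (pred n) z (root-of-P n H ehrhart z root)
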